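{- Let $n,k\ge 1$, let $0\le\gamma<1$, let $\mathbf{P}_1,\ldots,\mathbf{P}_k$ be symmetric stochastic $n\times n$ real matrices, and let $\boldsymbol{\mu}\in\mathbb{R}^n$ be a probability vector. For $\boldsymbol{\pi}\in\Delta$ put $\mathbf{M}_{\boldsymbol{\pi}}=\sum_{a=1}^k\pi_a\mathbf{P}_a$. Then the function $$f(\boldsymbol{\pi})=\boldsymbol{\mu}^\top\big(\mathbf{I}-\gamma\mathbf{M}_{\boldsymbol{\pi}}\big)^{ -1}\boldsymbol{\mu}$$ is convex in $\boldsymbol{\pi}\in\Delta$.
   Context: $\Delta=\{\boldsymbol{\pi}\in\mathbb{R}^k:\boldsymbol{\pi}\ge 0,\ \sum_{a=1}^k\pi_a=1\}$ is the standard probability simplex, and $\mathbf{I}$ is the $n\times n$ identity matrix. A stochastic matrix has nonnegative entries with each column summing to one (a symmetric one is therefore doubly stochastic). A probability vector has nonnegative entries summing to one. In the source setting, $\mathbf{P}_a(\bar s,s)=p(\bar s\mid s,a)$ is the transition matrix of action $a$ in a discounted Markov decision process with discount factor $\gamma$ and starting distribution $\boldsymbol{\mu}$. -}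

module Defs where

open import Algebra.Bundles.Raw using (RawMonoid)
import Algebra.Definitions.RawMonoid as RawMonoidDefinitions
open import Data.Bool.Base using (if_then_else_)
open import Data.Fin.Base using (Fin)
import Data.Fin.Properties as Fin
open import Data.Nat.Base as ℕ using (ℕ; _⊔_)
import Data.Nat.Properties as ℕ
open import Data.Product.Base using (Σ-syntax; _×_; _,_)
open import Data.Rational.Base as ℚ using (ℚ; 0ℚ; 1ℚ; ½; ∣_∣)
import Data.Rational.Properties as ℚ
open import Data.Rational.Solver using (module +-*-Solver)
open import Data.Vec.Functional using (Vector)
open import Level using (0ℓ)
open import Relation.Binary.PropositionalEquality using (_≡_; refl; sym; cong; subst)
open import Relation.Nullary.Decidable.Core using (does; toWitness)
open import Relation.Unary using (Pred; _∈_)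

------------------------------------------------------------------------
-- Real numbers: Cauchy sequences of rationals, each carrying a modulus of
-- convergence, as a setoid under _≃_.

Eventually : Pred ℕ 0ℓ → Set
Eventually Q = Σ[ N ∈ ℕ ] (∀ n → N ℕ.≤ n → Q n)

IsCauchy : (ℕ → ℚ) → Set
IsCauchy s = ∀ ε → 0ℚ ℚ.< ε →
  Σ[ N ∈ ℕ ] (∀ m n → N ℕ.≤ m → N ℕ.≤ n → ∣ s m ℚ.- s n ∣ ℚ.≤ ε)

record ℝ : Set where
  constructor mkℝ
  field
    seq    : ℕ → ℚ
    cauchy : IsCauchy seq

open ℝ public

infix 4 _≃_ _≤_ _<_

record _≃_ (x y : ℝ) : Set where
  constructor mk≃
  field
    close : ∀ ε → 0ℚ ℚ.< ε → Eventually (λ n → ∣ seq x n ℚ.- seq y n ∣ ℚ.≤ ε)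

record _≤_ (x y : ℝ) : Set where
  constructor mk≤
  field
    below : ∀ ε → 0ℚ ℚ.< ε → Eventually (λ n → seq x n ℚ.≤ seq y n ℚ.+ ε)

-- The gap is uniform: pointwise strict inequality would only give _≤_ in
-- the limit.
record _<_ (x y : ℝ) : Set where
  constructor mk<
  field
    gap      : ℚ
    gap>0    : 0ℚ ℚ.< gap
    separate : Eventually (λ n → seq x n ℚ.+ gap ℚ.≤ seq y n)

private
  open ℚ.≤-Reasoning

  -- Abstract, since these proofs are large and normalising them is never
  -- useful.
  abstract
    half : ℚ → ℚ
    half ε = ½ ℚ.* ε

    half>0 : ∀ {ε} → 0ℚ ℚ.< ε → 0ℚ ℚ.< half ε
    half>0 {ε} ε>0 = ℚ.positive⁻¹ (half ε)
      {{ℚ.pos*pos⇒pos ½ ε {{ℚ.positive ε>0}}}}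

    half+half : ∀ ε → half ε ℚ.+ half ε ≡ ε
    half+half = solve 1 (λ e → con ½ :* e :+ con ½ :* e := e) refl
      where open +-*-Solver

    const-cauchy : ∀ q → IsCauchy (λ _ → q)
    const-cauchy q ε ε>0 = 0 , λ _ _ _ _ → begin
      ∣ q ℚ.- q ∣  ≡⟨ cong ∣_∣ (ℚ.+-inverseʳ q) ⟩
      0ℚ           ≤⟨ ℚ.<⇒≤ ε>0 ⟩
      ε            ∎

    neg-cauchy : ∀ {s} → IsCauchy s → IsCauchy (λ n → ℚ.- s n)
    neg-cauchy {s} sᶜ ε ε>0 with sᶜ ε ε>0
    ... | N , h = N , λ m n N≤m N≤n → begin
      ∣ ℚ.- s m ℚ.- ℚ.- s n ∣  ≡⟨ cong ∣_∣ (sym (ℚ.neg-distrib-+ (s m) (ℚ.- s n))) ⟩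
      ∣ ℚ.- (s m ℚ.- s n) ∣    ≡⟨ ℚ.∣-p∣≡∣p∣ (s m ℚ.- s n) ⟩
      ∣ s m ℚ.- s n ∣          ≤⟨ h m n N≤m N≤n ⟩
      ε                        ∎

    +-cauchy : ∀ {s t} → IsCauchy s → IsCauchy t → IsCauchy (λ n → s n ℚ.+ t n)
    +-cauchy {s} {t} sᶜ tᶜ ε ε>0
      with sᶜ (half ε) (half>0 ε>0) | tᶜ (half ε) (half>0 ε>0)
    ... | N₁ , h₁ | N₂ , h₂ = N₁ ⊔ N₂ , λ m n N≤m N≤n → begin
      ∣ s m ℚ.+ t m ℚ.- (s n ℚ.+ t n) ∣
        ≡⟨ cong ∣_∣ (regroup (s m) (t m) (s n) (t n)) ⟩
      ∣ (s m ℚ.- s n) ℚ.+ (t m ℚ.- t n) ∣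
        ≤⟨ ℚ.∣p+q∣≤∣p∣+∣q∣ (s m ℚ.- s n) (t m ℚ.- t n) ⟩
      ∣ s m ℚ.- s n ∣ ℚ.+ ∣ t m ℚ.- t n ∣
        ≤⟨ ℚ.+-mono-≤
             (h₁ m n (ℕ.m⊔n≤o⇒m≤o N₁ N₂ N≤m) (ℕ.m⊔n≤o⇒m≤o N₁ N₂ N≤n))
             (h₂ m n (ℕ.m⊔n≤o⇒n≤o N₁ N₂ N≤m) (ℕ.m⊔n≤o⇒n≤o N₁ N₂ N≤n)) ⟩
      half ε ℚ.+ half ε
        ≡⟨ half+half ε ⟩
      ε ∎
      where
      regroup : ∀ a b c d →
        a ℚ.+ b ℚ.- (c ℚ.+ d) ≡ (a ℚ.- c) ℚ.+ (b ℚ.- d)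
      regroup = solve 4 (λ a b c d →
        a :+ b :- (c :+ d) := (a :- c) :+ (b :- d)) refl
        where open +-*-Solver

    0<1 : 0ℚ ℚ.< 1ℚ
    0<1 = toWitness {a? = 0ℚ ℚ.<? 1ℚ} _

    bounded : ∀ {s} → IsCauchy s →
      Σ[ B ∈ ℚ ] (0ℚ ℚ.< B × Eventually (λ n → ∣ s n ∣ ℚ.≤ B))
    bounded {s} sᶜ with sᶜ 1ℚ 0<1
    ... | N , h = 1ℚ ℚ.+ ∣ s N ∣ , B>0 , N , λ n N≤n → begin
      ∣ s n ∣                       ≡⟨ cong ∣_∣ (split (s n) (s N)) ⟩
      ∣ (s n ℚ.- s N) ℚ.+ s N ∣     ≤⟨ ℚ.∣p+q∣≤∣p∣+∣q∣ (s n ℚ.- s N) (s N) ⟩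
      ∣ s n ℚ.- s N ∣ ℚ.+ ∣ s N ∣   ≤⟨ ℚ.+-monoˡ-≤ ∣ s N ∣ (h n N N≤n ℕ.≤-refl) ⟩
      1ℚ ℚ.+ ∣ s N ∣                ∎
      where
      split : ∀ a b → a ≡ (a ℚ.- b) ℚ.+ b
      split = solve 2 (λ a b → a := (a :- b) :+ b) refl
        where open +-*-Solver

      B>0 : 0ℚ ℚ.< 1ℚ ℚ.+ ∣ s N ∣
      B>0 = ℚ.+-mono-<-≤ 0<1 (ℚ.0≤∣p∣ (s N))

    *-bound : ∀ p q {a b} → 0ℚ ℚ.< a → ∣ p ∣ ℚ.≤ a → ∣ q ∣ ℚ.≤ b →
      ∣ p ℚ.* q ∣ ℚ.≤ a ℚ.* b
    *-bound p q {a} {b} a>0 p≤a q≤b = begin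
      ∣ p ℚ.* q ∣      ≡⟨ ℚ.∣p*q∣≡∣p∣*∣q∣ p q ⟩
      ∣ p ∣ ℚ.* ∣ q ∣  ≤⟨ ℚ.*-monoʳ-≤-nonNeg ∣ q ∣ {{ℚ.nonNegative (ℚ.0≤∣p∣ q)}} p≤a ⟩
      a ℚ.* ∣ q ∣      ≤⟨ ℚ.*-monoˡ-≤-nonNeg a {{ℚ.nonNegative (ℚ.<⇒≤ a>0)}} q≤b ⟩
      a ℚ.* b          ∎

    divide : ∀ {B ε} → 0ℚ ℚ.< B → 0ℚ ℚ.< ε →
      Σ[ δ ∈ ℚ ] (0ℚ ℚ.< δ × B ℚ.* δ ≡ ε)
    divide {B} {ε} B>0 ε>0 = 1/B ℚ.* ε , δ>0 , B*δ≡ε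
      where
      instance
        B⁺ : ℚ.Positive B
        B⁺ = ℚ.positive B>0

        ε⁺ : ℚ.Positive ε
        ε⁺ = ℚ.positive ε>0

        B≢0 : ℚ.NonZero B
        B≢0 = ℚ.pos⇒nonZero B

      1/B : ℚ
      1/B = ℚ.1/ B

      δ>0 : 0ℚ ℚ.< 1/B ℚ.* ε
      δ>0 = ℚ.positive⁻¹ (1/B ℚ.* ε) {{ℚ.pos*pos⇒pos 1/B {{ℚ.1/pos⇒pos B}} ε}}

      B*δ≡ε : B ℚ.* (1/B ℚ.* ε) ≡ ε
      B*δ≡ε = begin-equality
        B ℚ.* (1/B ℚ.* ε)  ≡⟨ sym (ℚ.*-assoc B 1/B ε) ⟩
        B ℚ.* 1/B ℚ.* ε    ≡⟨ cong (ℚ._* ε) (ℚ.*-inverseʳ B) ⟩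
        1ℚ ℚ.* ε           ≡⟨ ℚ.*-identityˡ ε ⟩
        ε                  ∎

    *-close : ∀ p q p′ q′ {A B δ} → 0ℚ ℚ.< A → 0ℚ ℚ.< B →
      ∣ p ∣ ℚ.≤ A → ∣ q′ ∣ ℚ.≤ B →
      ∣ p ℚ.- p′ ∣ ℚ.≤ δ → ∣ q ℚ.- q′ ∣ ℚ.≤ δ →
      ∣ p ℚ.* q ℚ.- p′ ℚ.* q′ ∣ ℚ.≤ (A ℚ.+ B) ℚ.* δ
    *-close p q p′ q′ {A} {B} {δ} A>0 B>0 p≤A q′≤B p≈p′ q≈q′ = begin
      ∣ p ℚ.* q ℚ.- p′ ℚ.* q′ ∣
        ≡⟨ cong ∣_∣ (regroup p q p′ q′) ⟩
      ∣ p ℚ.* (q ℚ.- q′) ℚ.+ q′ ℚ.* (p ℚ.- p′) ∣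
        ≤⟨ ℚ.∣p+q∣≤∣p∣+∣q∣ (p ℚ.* (q ℚ.- q′)) (q′ ℚ.* (p ℚ.- p′)) ⟩
      ∣ p ℚ.* (q ℚ.- q′) ∣ ℚ.+ ∣ q′ ℚ.* (p ℚ.- p′) ∣
        ≤⟨ ℚ.+-mono-≤ (*-bound p (q ℚ.- q′) A>0 p≤A q≈q′)
                      (*-bound q′ (p ℚ.- p′) B>0 q′≤B p≈p′) ⟩
      A ℚ.* δ ℚ.+ B ℚ.* δ
        ≡⟨ sym (ℚ.*-distribʳ-+ δ A B) ⟩
      (A ℚ.+ B) ℚ.* δ ∎
      where
      regroup : ∀ a b c d →
        a ℚ.* b ℚ.- c ℚ.* d ≡ a ℚ.* (b ℚ.- d) ℚ.+ d ℚ.* (a ℚ.- c)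
      regroup = solve 4 (λ a b c d →
        a :* b :- c :* d := a :* (b :- d) :+ d :* (a :- c)) refl
        where open +-*-Solver

    *-cauchy : ∀ {s t} → IsCauchy s → IsCauchy t → IsCauchy (λ n → s n ℚ.* t n)
    *-cauchy {s} {t} sᶜ tᶜ ε ε>0 =
      let A , A>0 , N₁ , s≤A = bounded sᶜ
          B , B>0 , N₂ , t≤B = bounded tᶜ
          δ , δ>0 , [A+B]δ≡ε = divide (ℚ.+-mono-< A>0 B>0) ε>0
          N₃ , s-close = sᶜ δ δ>0
          N₄ , t-close = tᶜ δ δ>0
      in combine A A>0 B B>0 δ [A+B]δ≡ε N₁ s≤A N₂ t≤B N₃ s-close N₄ t-close
      where
      combine : ∀ A → 0ℚ ℚ.< A → ∀ B → 0ℚ ℚ.< B → ∀ δ → (A ℚ.+ B) ℚ.* δ ≡ ε →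
        ∀ N₁ → (∀ n → N₁ ℕ.≤ n → ∣ s n ∣ ℚ.≤ A) →
        ∀ N₂ → (∀ n → N₂ ℕ.≤ n → ∣ t n ∣ ℚ.≤ B) →
        ∀ N₃ → (∀ m n → N₃ ℕ.≤ m → N₃ ℕ.≤ n → ∣ s m ℚ.- s n ∣ ℚ.≤ δ) →
        ∀ N₄ → (∀ m n → N₄ ℕ.≤ m → N₄ ℕ.≤ n → ∣ t m ℚ.- t n ∣ ℚ.≤ δ) →
        Σ[ N ∈ ℕ ] (∀ m n → N ℕ.≤ m → N ℕ.≤ n →
          ∣ s m ℚ.* t m ℚ.- s n ℚ.* t n ∣ ℚ.≤ ε)
      combine A A>0 B B>0 δ [A+B]δ≡ε N₁ s≤A N₂ t≤B N₃ s-close N₄ t-close =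
        N₁ ⊔ N₂ ⊔ (N₃ ⊔ N₄) , λ m n N≤m N≤n →
          subst (∣ s m ℚ.* t m ℚ.- s n ℚ.* t n ∣ ℚ.≤_) [A+B]δ≡ε
            (*-close (s m) (t m) (s n) (t n) A>0 B>0
              (s≤A m (≤₁ N≤m)) (t≤B n (≤₂ N≤n))
              (s-close m n (≤₃ N≤m) (≤₃ N≤n)) (t-close m n (≤₄ N≤m) (≤₄ N≤n)))
        where
        ≤₁ : ∀ {o} → N₁ ⊔ N₂ ⊔ (N₃ ⊔ N₄) ℕ.≤ o → N₁ ℕ.≤ o
        ≤₁ p = ℕ.m⊔n≤o⇒m≤o N₁ N₂ (ℕ.m⊔n≤o⇒m≤o (N₁ ⊔ N₂) (N₃ ⊔ N₄) p)

        ≤₂ : ∀ {o} → N₁ ⊔ N₂ ⊔ (N₃ ⊔ N₄) ℕ.≤ o → N₂ ℕ.≤ o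
        ≤₂ p = ℕ.m⊔n≤o⇒n≤o N₁ N₂ (ℕ.m⊔n≤o⇒m≤o (N₁ ⊔ N₂) (N₃ ⊔ N₄) p)

        ≤₃ : ∀ {o} → N₁ ⊔ N₂ ⊔ (N₃ ⊔ N₄) ℕ.≤ o → N₃ ℕ.≤ o
        ≤₃ p = ℕ.m⊔n≤o⇒m≤o N₃ N₄ (ℕ.m⊔n≤o⇒n≤o (N₁ ⊔ N₂) (N₃ ⊔ N₄) p)

        ≤₄ : ∀ {o} → N₁ ⊔ N₂ ⊔ (N₃ ⊔ N₄) ℕ.≤ o → N₄ ℕ.≤ o
        ≤₄ p = ℕ.m⊔n≤o⇒n≤o N₃ N₄ (ℕ.m⊔n≤o⇒n≤o (N₁ ⊔ N₂) (N₃ ⊔ N₄) p)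

infixl 6 _+_ _-_
infixl 7 _*_
infix  8 -_

fromℚ : ℚ → ℝ
fromℚ q = mkℝ (λ _ → q) (const-cauchy q)

0ℝ 1ℝ : ℝ
0ℝ = fromℚ 0ℚ
1ℝ = fromℚ 1ℚ

_+_ : ℝ → ℝ → ℝ
x + y = mkℝ (λ n → seq x n ℚ.+ seq y n)
            (+-cauchy {seq x} {seq y} (cauchy x) (cauchy y))

-_ : ℝ → ℝ
- x = mkℝ (λ n → ℚ.- seq x n) (neg-cauchy {seq x} (cauchy x))

_-_ : ℝ → ℝ → ℝ
x - y = x + (- y)

_*_ : ℝ → ℝ → ℝ
x * y = mkℝ (λ n → seq x n ℚ.* seq y n)
            (*-cauchy {seq x} {seq y} (cauchy x) (cauchy y))

+-0-rawMonoid : RawMonoid 0ℓ 0ℓ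
+-0-rawMonoid = record { Carrier = ℝ ; _≈_ = _≃_ ; _∙_ = _+_ ; ε = 0ℝ }

open RawMonoidDefinitions +-0-rawMonoid public using (sum)

------------------------------------------------------------------------
-- Vectors and matrices

Matrix : ℕ → ℕ → Set
Matrix m n = Fin m → Fin n → ℝ

infix  4 _≋_
infixl 6 _⊖_
infixl 7 _⊗_ _·_ _*ᵥ_ _•_

_≋_ : ∀ {m n} → Matrix m n → Matrix m n → Set
A ≋ B = ∀ i j → A i j ≃ B i j

𝐈 : ∀ {n} → Matrix n n
𝐈 i j = if does (i Fin.≟ j) then 1ℝ else 0ℝ

_⊖_ : ∀ {m n} → Matrix m n → Matrix m n → Matrix m n
(A ⊖ B) i j = A i j - B i j

_•_ : ∀ {m n} → ℝ → Matrix m n → Matrix m n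
(c • A) i j = c * A i j

_⊗_ : ∀ {l m n} → Matrix l m → Matrix m n → Matrix l n
(A ⊗ B) i j = sum (λ k → A i k * B k j)

_·_ : ∀ {n} → Vector ℝ n → Vector ℝ n → ℝ
u · v = sum (λ i → u i * v i)

_*ᵥ_ : ∀ {m n} → Matrix m n → Vector ℝ n → Vector ℝ m
(A *ᵥ v) i = A i · v

record Invertible {n} (A : Matrix n n) : Set where
  field
    inverse  : Matrix n n
    inverseˡ : inverse ⊗ A ≋ 𝐈
    inverseʳ : A ⊗ inverse ≋ 𝐈

open Invertible public using (inverse)

IsSymmetric : ∀ {n} → Matrix n n → Set
IsSymmetric A = ∀ i j → A i j ≃ A j i

------------------------------------------------------------------------
-- Probability

IsProbability : ∀ {n} → Pred (Vector ℝ n) 0ℓ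
IsProbability v = (∀ i → 0ℝ ≤ v i) × sum v ≃ 1ℝ

Δ : ∀ k → Pred (Vector ℝ k) 0ℓ
Δ k = IsProbability

-- Columns, not rows, sum to one.
IsStochastic : ∀ {n} → Matrix n n → Set
IsStochastic A = (∀ i j → 0ℝ ≤ A i j) × (∀ j → sum (λ i → A i j) ≃ 1ℝ)

mixture : ∀ {k n} → (Fin k → Matrix n n) → Vector ℝ k → Matrix n n
mixture P π i j = sum (λ a → π a * P a i j)

------------------------------------------------------------------------
-- Convexity

segment : ∀ {k} → ℝ → Vector ℝ k → Vector ℝ k → Vector ℝ k
segment t x y i = t * x i + (1ℝ - t) * y i

IsConvex : ∀ {k} → Pred (Vector ℝ k) 0ℓ → Set
IsConvex D = ∀ x y t → x ∈ D → y ∈ D → 0ℝ ≤ t → t ≤ 1ℝ → segment t x y ∈ D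

-- The function is only defined on D, so its values depend a priori on
-- membership proofs; the inequality is required for all of them.
record IsConvexOn {k} (D : Pred (Vector ℝ k) 0ℓ) (f : ∀ x → x ∈ D → ℝ) : Set where
  field
    domain : IsConvex D
    below-chord : ∀ x y t (x∈D : x ∈ D) (y∈D : y ∈ D) → 0ℝ ≤ t → t ≤ 1ℝ →
      (z∈D : segment t x y ∈ D) →
      f (segment t x y) z∈D ≤ t * f x x∈D + (1ℝ - t) * f y y∈D

{-# OPTIONS --safe #-}
module Submission where

-- Write A_π = I − γ M_π.  It is symmetric, affine in π, and positive
-- semidefinite, since 2 (v·v − v·Mv) = Σᵢⱼ Mᵢⱼ (vᵢ − vⱼ)² for a doubly
-- stochastic M.  Hence (p − u)·A_π(p − u) ≥ 0 for p = A_π⁻¹μ, that is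
-- μ·A_π⁻¹μ ≥ 2 u·μ − u·A_π u for every u, with equality at u = p: f is a
-- supremum of functions affine in π.
--
-- A_π has nonpositive off-diagonal entries and row sums 1 − γ, bounded below
-- by a positive rational; both properties survive Gaussian elimination, which
-- therefore never meets a small pivot and solves A_π x = v constructively.
-- By symmetry the right inverse so obtained is two-sided.

open import Algebra.Bundles using (CommutativeRing)
import Algebra.Properties.Semiring.Sum as SemiringSum
import Algebra.Solver.Ring as RingSolver
open import Algebra.Solver.Ring.AlmostCommutativeRing
  using (fromCommutativeRing; _-Raw-AlmostCommutative⟶_)
open import Data.Fin.Base using (Fin; zero; suc)
import Data.Fin.Properties as Fin
open import Data.Maybe.Base using (just; nothing)
open import Data.Nat.Base as ℕ using (ℕ; NonZero; _⊔_)
import Data.Nat.Properties as ℕ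
open import Data.Product.Base using (Σ-syntax; _×_; _,_; proj₁; proj₂)
open import Data.Rational.Base as ℚ using (ℚ; 0ℚ; 1ℚ; ½; ∣_∣)
import Data.Rational.Properties as ℚ
open import Data.Rational.Solver using (module +-*-Solver)
open import Data.Sum.Base using (inj₁; inj₂)
open import Data.Vec.Functional using (Vector; _∷_)
open import Function.Base using (_∘_)
open import Level using (0ℓ)
open import Relation.Binary.Definitions using (WeaklyDecidable)
open import Relation.Binary.PropositionalEquality as ≡ using (_≡_; _≢_)
import Relation.Binary.Reasoning.Setoid as SetoidReasoning
open import Relation.Nullary.Decidable.Core using (yes; no; toWitness)
open import Relation.Nullary.Negation.Core using (contradiction)
open import Relation.Unary using (Pred; _∈_; _⊆_; _∩_)
open import Defs

-- Rational inequalities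

p≤∣p∣ : ∀ p → p ℚ.≤ ∣ p ∣
p≤∣p∣ p with ℚ.≤-total 0ℚ p
... | inj₁ 0≤p = ℚ.≤-reflexive (≡.sym (ℚ.0≤p⇒∣p∣≡p 0≤p))
... | inj₂ p≤0 = ℚ.≤-trans p≤0 (ℚ.0≤∣p∣ p)

∣p-q∣≤⇒p≤q+ : ∀ p q {ε} → ∣ p ℚ.- q ∣ ℚ.≤ ε → p ℚ.≤ q ℚ.+ ε
∣p-q∣≤⇒p≤q+ p q {ε} close = begin
  p                ≡⟨ solve 2 (λ p q → p := q :+ (p :- q)) ≡.refl p q ⟩
  q ℚ.+ (p ℚ.- q)  ≤⟨ ℚ.+-monoʳ-≤ q (ℚ.≤-trans (p≤∣p∣ (p ℚ.- q)) close) ⟩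
  q ℚ.+ ε          ∎
  where
  open ℚ.≤-Reasoning
  open +-*-Solver

∣p-q∣≡∣q-p∣ : ∀ p q → ∣ p ℚ.- q ∣ ≡ ∣ q ℚ.- p ∣
∣p-q∣≡∣q-p∣ p q = ≡.trans
  (≡.cong ∣_∣ (solve 2 (λ p q → p :- q := :- (q :- p)) ≡.refl p q))
  (ℚ.∣-p∣≡∣p∣ (q ℚ.- p))
  where open +-*-Solver

p≤q+⇒p-q≤ : ∀ p q {ε} → p ℚ.≤ q ℚ.+ ε → p ℚ.- q ℚ.≤ ε
p≤q+⇒p-q≤ p q {ε} p≤q+ε = begin
  p ℚ.- q          ≤⟨ ℚ.+-monoˡ-≤ (ℚ.- q) p≤q+ε ⟩
  q ℚ.+ ε ℚ.- q    ≡⟨ solve 2 (λ q ε → q :+ ε :- q := ε) ≡.refl q ε ⟩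
  ε                ∎
  where
  open ℚ.≤-Reasoning
  open +-*-Solver

≤+×≤+⇒∣p-q∣≤ : ∀ p q {ε} → p ℚ.≤ q ℚ.+ ε → q ℚ.≤ p ℚ.+ ε → ∣ p ℚ.- q ∣ ℚ.≤ ε
≤+×≤+⇒∣p-q∣≤ p q {ε} p≤q+ε q≤p+ε with ℚ.∣p∣≡p∨∣p∣≡-p (p ℚ.- q)
... | inj₁ eq = ≡.subst (ℚ._≤ ε) (≡.sym eq) (p≤q+⇒p-q≤ p q p≤q+ε)
... | inj₂ eq = ≡.subst (ℚ._≤ ε)
  (≡.trans (solve 2 (λ p q → q :- p := :- (p :- q)) ≡.refl p q) (≡.sym eq))
  (p≤q+⇒p-q≤ q p q≤p+ε)
  where open +-*-Solver

p≤p+ : ∀ p {ε} → 0ℚ ℚ.< ε → p ℚ.≤ p ℚ.+ ε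
p≤p+ p {ε} ε>0 = ≡.subst (ℚ._≤ p ℚ.+ ε) (ℚ.+-identityʳ p) (ℚ.+-monoʳ-≤ p (ℚ.<⇒≤ ε>0))

0≤p*q : ∀ {p q} → 0ℚ ℚ.≤ p → 0ℚ ℚ.≤ q → 0ℚ ℚ.≤ p ℚ.* q
0≤p*q {p} {q} 0≤p 0≤q = ℚ.nonNegative⁻¹ (p ℚ.* q)
  {{ℚ.nonNeg*nonNeg⇒nonNeg p {{ℚ.nonNegative 0≤p}} q {{ℚ.nonNegative 0≤q}}}}

0<p*q : ∀ {p q} → 0ℚ ℚ.< p → 0ℚ ℚ.< q → 0ℚ ℚ.< p ℚ.* q
0<p*q {p} {q} 0<p 0<q = ℚ.positive⁻¹ (p ℚ.* q)
  {{ℚ.pos*pos⇒pos p {{ℚ.positive 0<p}} q {{ℚ.positive 0<q}}}}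

0≤p*p : ∀ p → 0ℚ ℚ.≤ p ℚ.* p
0≤p*p p with ℚ.≤-total 0ℚ p
... | inj₁ 0≤p = 0≤p*q 0≤p 0≤p
... | inj₂ p≤0 = ≡.subst (0ℚ ℚ.≤_)
  (solve 1 (λ p → (:- p) :* (:- p) := p :* p) ≡.refl p)
  (0≤p*q (ℚ.neg-antimono-≤ p≤0) (ℚ.neg-antimono-≤ p≤0))
  where open +-*-Solver

*-mono-≤ : ∀ {p p′ q q′} → 0ℚ ℚ.≤ p′ → 0ℚ ℚ.≤ q → p ℚ.≤ p′ → q ℚ.≤ q′ → p ℚ.* q ℚ.≤ p′ ℚ.* q′
*-mono-≤ {p′ = p′} {q} 0≤p′ 0≤q p≤p′ q≤q′ = ℚ.≤-trans
  (ℚ.*-monoʳ-≤-nonNeg q {{ℚ.nonNegative 0≤q}} p≤p′)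
  (ℚ.*-monoˡ-≤-nonNeg p′ {{ℚ.nonNegative 0≤p′}} q≤q′)

-- Opaque, so that type checking never unfolds this rational arithmetic: later proofs use only
-- positivity and the two equations. A reciprocal takes a proof of positivity, the form in which
-- every divisor below is known to be nonzero.
abstract
  half : ℚ → ℚ
  half ε = ½ ℚ.* ε

  half>0 : ∀ {ε} → 0ℚ ℚ.< ε → 0ℚ ℚ.< half ε
  half>0 {ε} ε>0 = ℚ.positive⁻¹ (half ε) {{ℚ.pos*pos⇒pos ½ ε {{ℚ.positive ε>0}}}}

  half+half : ∀ ε → half ε ℚ.+ half ε ≡ ε
  half+half = solve 1 (λ e → con ½ :* e :+ con ½ :* e := e) ≡.refl
    where open +-*-Solver

  reciprocal : ∀ {p} → 0ℚ ℚ.< p → ℚ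
  reciprocal {p} p>0 = ℚ.1/_ p {{ℚ.pos⇒nonZero p {{ℚ.positive p>0}}}}

  reciprocal>0 : ∀ {p} (p>0 : 0ℚ ℚ.< p) → 0ℚ ℚ.< reciprocal p>0
  reciprocal>0 {p} p>0 = ℚ.positive⁻¹ (reciprocal p>0) {{ℚ.1/pos⇒pos p {{ℚ.positive p>0}}}}

  *-reciprocal : ∀ {p} (p>0 : 0ℚ ℚ.< p) → p ℚ.* reciprocal p>0 ≡ 1ℚ
  *-reciprocal {p} p>0 = ℚ.*-inverseʳ p {{ℚ.pos⇒nonZero p {{ℚ.positive p>0}}}}

0<1 : 0ℚ ℚ.< 1ℚ
0<1 = toWitness {a? = 0ℚ ℚ.<? 1ℚ} _

*-reciprocal-* : ∀ {p} (p>0 : 0ℚ ℚ.< p) q → p ℚ.* (reciprocal p>0 ℚ.* q) ≡ q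
*-reciprocal-* {p} p>0 q = ≡.trans (≡.sym (ℚ.*-assoc p (reciprocal p>0) q))
  (≡.trans (≡.cong (ℚ._* q) (*-reciprocal p>0)) (ℚ.*-identityˡ q))

-- Truncation from below is 1-Lipschitz, so a truncated Cauchy sequence keeps its modulus.
∣⊔-⊔∣≤ : ∀ p q c → ∣ (p ℚ.⊔ c) ℚ.- (q ℚ.⊔ c) ∣ ℚ.≤ ∣ p ℚ.- q ∣
∣⊔-⊔∣≤ p q c = ≤+×≤+⇒∣p-q∣≤ (p ℚ.⊔ c) (q ℚ.⊔ c) (one-sided p q)
  (≡.subst (λ d → q ℚ.⊔ c ℚ.≤ (p ℚ.⊔ c) ℚ.+ d) (∣p-q∣≡∣q-p∣ q p) (one-sided q p))
  where
  one-sided : ∀ p q → p ℚ.⊔ c ℚ.≤ (q ℚ.⊔ c) ℚ.+ ∣ p ℚ.- q ∣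
  one-sided p q = ℚ.⊔-lub
    (ℚ.≤-trans (∣p-q∣≤⇒p≤q+ p q ℚ.≤-refl) (ℚ.+-monoˡ-≤ ∣ p ℚ.- q ∣ (ℚ.p≤p⊔q q c)))
    (≡.subst (ℚ._≤ (q ℚ.⊔ c) ℚ.+ ∣ p ℚ.- q ∣) (ℚ.+-identityʳ c)
      (ℚ.+-mono-≤ (ℚ.p≤q⊔p q c) (ℚ.0≤∣p∣ (p ℚ.- q))))

-- 1/p − 1/q = (1/p)(1/q)(q − p), and both reciprocals are at most 1/δ.
∣reciprocal-reciprocal∣≤ : ∀ {p q δ} (p>0 : 0ℚ ℚ.< p) (q>0 : 0ℚ ℚ.< q) (δ>0 : 0ℚ ℚ.< δ) →
  δ ℚ.≤ p → δ ℚ.≤ q →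
  ∣ reciprocal p>0 ℚ.- reciprocal q>0 ∣ ℚ.≤
    reciprocal δ>0 ℚ.* reciprocal δ>0 ℚ.* ∣ p ℚ.- q ∣
∣reciprocal-reciprocal∣≤ {p} {q} {δ} p>0 q>0 δ>0 δ≤p δ≤q = begin
  ∣ 1/p ℚ.- 1/q ∣
    ≡⟨ ≡.cong ∣_∣ difference ⟩
  ∣ 1/p ℚ.* 1/q ℚ.* (q ℚ.- p) ∣
    ≡⟨ ℚ.∣p*q∣≡∣p∣*∣q∣ (1/p ℚ.* 1/q) (q ℚ.- p) ⟩
  ∣ 1/p ℚ.* 1/q ∣ ℚ.* ∣ q ℚ.- p ∣
    ≡⟨ ≡.cong₂ ℚ._*_ (ℚ.0≤p⇒∣p∣≡p (ℚ.<⇒≤ (0<p*q (reciprocal>0 p>0) (reciprocal>0 q>0))))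
         (∣p-q∣≡∣q-p∣ q p) ⟩
  1/p ℚ.* 1/q ℚ.* ∣ p ℚ.- q ∣
    ≤⟨ ℚ.*-monoʳ-≤-nonNeg ∣ p ℚ.- q ∣ {{ℚ.nonNegative (ℚ.0≤∣p∣ (p ℚ.- q))}}
         (*-mono-≤ (ℚ.<⇒≤ (reciprocal>0 δ>0)) (ℚ.<⇒≤ (reciprocal>0 q>0))
           (antitone p>0 δ≤p) (antitone q>0 δ≤q)) ⟩
  1/δ ℚ.* 1/δ ℚ.* ∣ p ℚ.- q ∣ ∎
  where
  open ℚ.≤-Reasoning
  open +-*-Solver
  1/p 1/q 1/δ : ℚ
  1/p = reciprocal p>0
  1/q = reciprocal q>0
  1/δ = reciprocal δ>0

  difference : 1/p ℚ.- 1/q ≡ 1/p ℚ.* 1/q ℚ.* (q ℚ.- p)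
  difference = begin-equality
    1/p ℚ.- 1/q
      ≡⟨ solve 2 (λ a b → a :- b := a :* con 1ℚ :- b :* con 1ℚ) ≡.refl 1/p 1/q ⟩
    1/p ℚ.* 1ℚ ℚ.- 1/q ℚ.* 1ℚ
      ≡⟨ ≡.cong₂ (λ a b → 1/p ℚ.* a ℚ.- 1/q ℚ.* b) (*-reciprocal q>0) (*-reciprocal p>0) ⟨
    1/p ℚ.* (q ℚ.* 1/q) ℚ.- 1/q ℚ.* (p ℚ.* 1/p)
      ≡⟨ solve 4 (λ a b p q → a :* (q :* b) :- b :* (p :* a) := a :* b :* (q :- p))
           ≡.refl 1/p 1/q p q ⟩
    1/p ℚ.* 1/q ℚ.* (q ℚ.- p) ∎

  -- Both reciprocals are written as multiples of the positive product `1/δ ℚ.* 1/r`, with factors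
  -- `δ` and `r`.
  antitone : ∀ {r} (r>0 : 0ℚ ℚ.< r) → δ ℚ.≤ r → reciprocal r>0 ℚ.≤ 1/δ
  antitone {r} r>0 δ≤r = begin
    1/r                       ≡⟨ *-reciprocal-* δ>0 1/r ⟨
    δ ℚ.* (1/δ ℚ.* 1/r)       ≤⟨ ℚ.*-monoʳ-≤-nonNeg (1/δ ℚ.* 1/r)
                                   {{ℚ.nonNegative (ℚ.<⇒≤ (0<p*q (reciprocal>0 δ>0) (reciprocal>0 r>0)))}} δ≤r ⟩
    r ℚ.* (1/δ ℚ.* 1/r)       ≡⟨ ≡.cong (r ℚ.*_) (ℚ.*-comm 1/δ 1/r) ⟩
    r ℚ.* (1/r ℚ.* 1/δ)       ≡⟨ *-reciprocal-* r>0 1/δ ⟩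
    1/δ                       ∎
    where
    1/r : ℚ
    1/r = reciprocal r>0

-- Order and ring structure of the reals

map-eventually : ∀ {Q R : Pred ℕ 0ℓ} → Q ⊆ R → Eventually Q → Eventually R
map-eventually f (N , q) = N , λ n N≤n → f (q n N≤n)

always : ∀ {Q : Pred ℕ 0ℓ} → (∀ n → Q n) → Eventually Q
always q = 0 , λ n _ → q n

infixr 5 _⊗ᵉ_

_⊗ᵉ_ : ∀ {Q R : Pred ℕ 0ℓ} → Eventually Q → Eventually R → Eventually (Q ∩ R)
(N₁ , q) ⊗ᵉ (N₂ , r) = N₁ ⊔ N₂ , λ n N≤n →
  q n (ℕ.m⊔n≤o⇒m≤o N₁ N₂ N≤n) , r n (ℕ.m⊔n≤o⇒n≤o N₁ N₂ N≤n)

≤-pointwise : ∀ {x y} → (∀ n → seq x n ℚ.≤ seq y n) → x ≤ y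
≤-pointwise {y = y} x≤y = mk≤ λ ε ε>0 → always λ n → ℚ.≤-trans (x≤y n) (p≤p+ (seq y n) ε>0)

≤-trans : ∀ {x y z} → x ≤ y → y ≤ z → x ≤ z
≤-trans {x} {y} {z} (mk≤ x≤y) (mk≤ y≤z) = mk≤ λ ε ε>0 →
  map-eventually (λ {n} (x≤ , y≤) → combine ε (seq z n) x≤ y≤)
    (x≤y (half ε) (half>0 ε>0) ⊗ᵉ y≤z (half ε) (half>0 ε>0))
  where
  open ℚ.≤-Reasoning
  combine : ∀ ε {p q} r → p ℚ.≤ q ℚ.+ half ε → q ℚ.≤ r ℚ.+ half ε → p ℚ.≤ r ℚ.+ ε
  combine ε {p} {q} r p≤q q≤r = begin
    p                            ≤⟨ p≤q ⟩
    q ℚ.+ half ε                 ≤⟨ ℚ.+-monoˡ-≤ (half ε) q≤r ⟩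
    r ℚ.+ half ε ℚ.+ half ε      ≡⟨ ℚ.+-assoc r (half ε) (half ε) ⟩
    r ℚ.+ (half ε ℚ.+ half ε)    ≡⟨ ≡.cong (r ℚ.+_) (half+half ε) ⟩
    r ℚ.+ ε                      ∎

≤-antisym : ∀ {x y} → x ≤ y → y ≤ x → x ≃ y
≤-antisym {x} {y} (mk≤ x≤y) (mk≤ y≤x) = mk≃ λ ε ε>0 →
  map-eventually (λ {n} (x≤ , y≤) → ≤+×≤+⇒∣p-q∣≤ (seq x n) (seq y n) x≤ y≤)
    (x≤y ε ε>0 ⊗ᵉ y≤x ε ε>0)

≃⇒≤ : ∀ {x y} → x ≃ y → x ≤ y
≃⇒≤ {x} {y} (mk≃ x≃y) = mk≤ λ ε ε>0 →
  map-eventually (λ {n} → ∣p-q∣≤⇒p≤q+ (seq x n) (seq y n)) (x≃y ε ε>0)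

≃-sym : ∀ {x y} → x ≃ y → y ≃ x
≃-sym {x} {y} (mk≃ x≃y) = mk≃ λ ε ε>0 →
  map-eventually (λ {n} → ≡.subst (ℚ._≤ ε) (∣p-q∣≡∣q-p∣ (seq x n) (seq y n))) (x≃y ε ε>0)

-- Obtained through the order, so that the splitting of ε into halves is done once, in `≤-trans`.
≃-trans : ∀ {x y z} → x ≃ y → y ≃ z → x ≃ z
≃-trans x≃y y≃z = ≤-antisym (≤-trans (≃⇒≤ x≃y) (≃⇒≤ y≃z))
  (≤-trans (≃⇒≤ (≃-sym y≃z)) (≃⇒≤ (≃-sym x≃y)))

-- The operations on reals act termwise, so each ring identity of ℚ passes to ℝ through this lemma.
≃-pointwise : ∀ {x y} → (∀ n → seq x n ≡ seq y n) → x ≃ y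
≃-pointwise {x} {y} x≡y = ≤-antisym
  (≤-pointwise {x} {y} λ n → ℚ.≤-reflexive (x≡y n))
  (≤-pointwise {y} {x} λ n → ℚ.≤-reflexive (≡.sym (x≡y n)))

≃-refl : ∀ {x} → x ≃ x
≃-refl = ≃-pointwise λ _ → ≡.refl

+-mono-≤ : ∀ {x x′ y y′} → x ≤ x′ → y ≤ y′ → x + y ≤ x′ + y′
+-mono-≤ {x} {x′} {y} {y′} (mk≤ x≤x′) (mk≤ y≤y′) = mk≤ λ ε ε>0 →
  map-eventually (λ {n} (x≤ , y≤) → combine n ε x≤ y≤)
    (x≤x′ (half ε) (half>0 ε>0) ⊗ᵉ y≤y′ (half ε) (half>0 ε>0))
  where
  open ℚ.≤-Reasoning
  open +-*-Solver
  combine : ∀ n ε → seq x n ℚ.≤ seq x′ n ℚ.+ half ε → seq y n ℚ.≤ seq y′ n ℚ.+ half ε →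
    seq x n ℚ.+ seq y n ℚ.≤ seq x′ n ℚ.+ seq y′ n ℚ.+ ε
  combine n ε x≤ y≤ = begin
    seq x n ℚ.+ seq y n
      ≤⟨ ℚ.+-mono-≤ x≤ y≤ ⟩
    seq x′ n ℚ.+ half ε ℚ.+ (seq y′ n ℚ.+ half ε)
      ≡⟨ solve 3 (λ a b h → a :+ h :+ (b :+ h) := a :+ b :+ (h :+ h))
           ≡.refl (seq x′ n) (seq y′ n) (half ε) ⟩
    seq x′ n ℚ.+ seq y′ n ℚ.+ (half ε ℚ.+ half ε)
      ≡⟨ ≡.cong (seq x′ n ℚ.+ seq y′ n ℚ.+_) (half+half ε) ⟩
    seq x′ n ℚ.+ seq y′ n ℚ.+ ε ∎

+-cong : ∀ {x x′ y y′} → x ≃ x′ → y ≃ y′ → x + y ≃ x′ + y′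
+-cong x≃x′ y≃y′ = ≤-antisym (+-mono-≤ (≃⇒≤ x≃x′) (≃⇒≤ y≃y′))
  (+-mono-≤ (≃⇒≤ (≃-sym x≃x′)) (≃⇒≤ (≃-sym y≃y′)))

neg-cong : ∀ {x y} → x ≃ y → - x ≃ - y
neg-cong {x} {y} (mk≃ x≃y) = mk≃ λ ε ε>0 →
  map-eventually (λ {n} → ≡.subst (ℚ._≤ ε) (∣neg∣ (seq x n) (seq y n))) (x≃y ε ε>0)
  where
  ∣neg∣ : ∀ p q → ∣ p ℚ.- q ∣ ≡ ∣ ℚ.- p ℚ.- ℚ.- q ∣
  ∣neg∣ p q = ≡.trans (≡.sym (ℚ.∣-p∣≡∣p∣ (p ℚ.- q)))
    (≡.cong ∣_∣ (ℚ.neg-distrib-+ p (ℚ.- q)))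

bounded : ∀ x → Σ[ B ∈ ℚ ] (0ℚ ℚ.< B × Eventually (λ n → ∣ seq x n ∣ ℚ.≤ B))
bounded x with cauchy x 1ℚ 0<1
... | N , close = 1ℚ ℚ.+ ∣ xN ∣ , ℚ.+-mono-<-≤ 0<1 (ℚ.0≤∣p∣ xN) , N , λ n N≤n → begin
  ∣ seq x n ∣                    ≡⟨ ≡.cong ∣_∣ (solve 2 (λ a b → a := a :- b :+ b) ≡.refl (seq x n) xN) ⟩
  ∣ seq x n ℚ.- xN ℚ.+ xN ∣      ≤⟨ ℚ.∣p+q∣≤∣p∣+∣q∣ (seq x n ℚ.- xN) xN ⟩
  ∣ seq x n ℚ.- xN ∣ ℚ.+ ∣ xN ∣  ≤⟨ ℚ.+-monoˡ-≤ ∣ xN ∣ (close n N N≤n ℕ.≤-refl) ⟩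
  1ℚ ℚ.+ ∣ xN ∣                  ∎
  where
  open ℚ.≤-Reasoning
  open +-*-Solver
  xN : ℚ
  xN = seq x N

-- Multiplication by `x` stretches distances by at most an eventual bound `B` of its terms, so
-- closeness within ε/B suffices.
*-congˡ : ∀ x {y y′} → y ≃ y′ → x * y ≃ x * y′
*-congˡ x {y} {y′} (mk≃ y≃y′) = mk≃ λ ε ε>0 →
  map-eventually (λ {n} (x≤ , close) → scale n ε x≤ close)
    (x≤B ⊗ᵉ y≃y′ (reciprocal B>0 ℚ.* ε) (0<p*q (reciprocal>0 B>0) ε>0))
  where
  B : ℚ
  B = proj₁ (bounded x)
  B>0 : 0ℚ ℚ.< B
  B>0 = proj₁ (proj₂ (bounded x))
  x≤B : Eventually (λ n → ∣ seq x n ∣ ℚ.≤ B)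
  x≤B = proj₂ (proj₂ (bounded x))
  open ℚ.≤-Reasoning
  open +-*-Solver
  scale : ∀ n ε → ∣ seq x n ∣ ℚ.≤ B → ∣ seq y n ℚ.- seq y′ n ∣ ℚ.≤ reciprocal B>0 ℚ.* ε →
    ∣ seq x n ℚ.* seq y n ℚ.- seq x n ℚ.* seq y′ n ∣ ℚ.≤ ε
  scale n ε x≤ close = begin
    ∣ seq x n ℚ.* seq y n ℚ.- seq x n ℚ.* seq y′ n ∣
      ≡⟨ ≡.cong ∣_∣ (solve 3 (λ a b c → a :* b :- a :* c := a :* (b :- c))
           ≡.refl (seq x n) (seq y n) (seq y′ n)) ⟩
    ∣ seq x n ℚ.* (seq y n ℚ.- seq y′ n) ∣
      ≡⟨ ℚ.∣p*q∣≡∣p∣*∣q∣ (seq x n) (seq y n ℚ.- seq y′ n) ⟩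
    ∣ seq x n ∣ ℚ.* ∣ seq y n ℚ.- seq y′ n ∣
      ≤⟨ *-mono-≤ (ℚ.<⇒≤ B>0) (ℚ.0≤∣p∣ (seq y n ℚ.- seq y′ n)) x≤ close ⟩
    B ℚ.* (reciprocal B>0 ℚ.* ε)
      ≡⟨ *-reciprocal-* B>0 ε ⟩
    ε ∎

*-comm : ∀ x y → x * y ≃ y * x
*-comm x y = ≃-pointwise λ n → ℚ.*-comm (seq x n) (seq y n)

*-cong : ∀ {x x′ y y′} → x ≃ x′ → y ≃ y′ → x * y ≃ x′ * y′
*-cong {x} {x′} {y} {y′} x≃x′ y≃y′ = ≃-trans (*-congˡ x y≃y′)
  (≃-trans (*-comm x y′) (≃-trans (*-congˡ y′ x≃x′) (*-comm y′ x′)))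

-- The commutative ring of reals and its solver.

+-*-commutativeRing : CommutativeRing 0ℓ 0ℓ
+-*-commutativeRing = record
  { Carrier = ℝ ; _≈_ = _≃_ ; _+_ = _+_ ; _*_ = _*_ ; -_ = -_ ; 0# = 0ℝ ; 1# = 1ℝ
  ; isCommutativeRing = record
    { isRing = record
      { +-isAbelianGroup = record
        { isGroup = record
          { isMonoid = record
            { isSemigroup = record
              { isMagma = record
                { isEquivalence = record { refl = ≃-refl ; sym = ≃-sym ; trans = ≃-trans }
                ; ∙-cong = +-cong
                }
              ; assoc = λ x y z → ≃-pointwise λ n → ℚ.+-assoc (seq x n) (seq y n) (seq z n)
              }
            ; identity = (λ x → ≃-pointwise λ n → ℚ.+-identityˡ (seq x n))
                       , (λ x → ≃-pointwise λ n → ℚ.+-identityʳ (seq x n))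
            }
          ; inverse = (λ x → ≃-pointwise λ n → ℚ.+-inverseˡ (seq x n))
                    , (λ x → ≃-pointwise λ n → ℚ.+-inverseʳ (seq x n))
          ; ⁻¹-cong = neg-cong
          }
        ; comm = λ x y → ≃-pointwise λ n → ℚ.+-comm (seq x n) (seq y n)
        }
      ; *-cong = *-cong
      ; *-assoc = λ x y z → ≃-pointwise λ n → ℚ.*-assoc (seq x n) (seq y n) (seq z n)
      ; *-identity = (λ x → ≃-pointwise λ n → ℚ.*-identityˡ (seq x n))
                   , (λ x → ≃-pointwise λ n → ℚ.*-identityʳ (seq x n))
      ; distrib = (λ x y z → ≃-pointwise λ n → ℚ.*-distribˡ-+ (seq x n) (seq y n) (seq z n))
                , (λ x y z → ≃-pointwise λ n → ℚ.*-distribʳ-+ (seq x n) (seq y n) (seq z n))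
      }
    ; *-comm = *-comm
    }
  }

open CommutativeRing +-*-commutativeRing using (setoid; semiring; +-congˡ; +-congʳ; *-assoc)
open SemiringSum semiring
  using (sum-cong-≋; ∑-distrib-+; ∑-comm; *-distribˡ-sum; *-distribʳ-sum; sum-replicate-zero)
module ≃-Reasoning = SetoidReasoning setoid

-- Coefficients are taken in ℚ, where equality is decidable, so the solver can compute with
-- constants such as `½`.
fromℚ-homomorphism : ℚ.+-*-rawRing -Raw-AlmostCommutative⟶ fromCommutativeRing +-*-commutativeRing
fromℚ-homomorphism = record
  { ⟦_⟧    = fromℚ
  ; +-homo = λ _ _ → ≃-pointwise λ _ → ≡.refl
  ; *-homo = λ _ _ → ≃-pointwise λ _ → ≡.refl
  ; -‿homo = λ _ → ≃-pointwise λ _ → ≡.refl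
  ; 0-homo = ≃-refl
  ; 1-homo = ≃-refl
  }

fromℚ-≟ : WeaklyDecidable (λ p q → fromℚ p ≃ fromℚ q)
fromℚ-≟ p q with p ℚ.≟ q
... | yes p≡q = just (≃-pointwise λ _ → p≡q)
... | no  _   = nothing

module ℝ-Solver = RingSolver ℚ.+-*-rawRing
  (fromCommutativeRing +-*-commutativeRing) fromℚ-homomorphism fromℚ-≟

-- Order and multiplication, clamping and reciprocals.

x≤y⇒0≤y-x : ∀ {x y} → x ≤ y → 0ℝ ≤ y - x
x≤y⇒0≤y-x {x} {y} x≤y = ≤-trans
  (≃⇒≤ (solve 1 (λ x → con 0ℚ := x :- x) ≃-refl x))
  (+-mono-≤ x≤y (≃⇒≤ (≃-refl { - x})))
  where open ℝ-Solver

0≤y-x⇒x≤y : ∀ {x y} → 0ℝ ≤ y - x → x ≤ y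
0≤y-x⇒x≤y {x} {y} 0≤y-x = ≤-trans
  (≃⇒≤ (solve 1 (λ x → x := con 0ℚ :+ x) ≃-refl x))
  (≤-trans (+-mono-≤ 0≤y-x (≃⇒≤ (≃-refl {x})))
    (≃⇒≤ (solve 2 (λ x y → y :- x :+ x := y) ≃-refl x y)))
  where open ℝ-Solver

x≤0⇒0≤-x : ∀ {x} → x ≤ 0ℝ → 0ℝ ≤ - x
x≤0⇒0≤-x {x} x≤0 = ≤-trans (x≤y⇒0≤y-x x≤0)
  (≃⇒≤ (solve 1 (λ x → con 0ℚ :- x := :- x) ≃-refl x))
  where open ℝ-Solver

0≤x+y : ∀ {x y} → 0ℝ ≤ x → 0ℝ ≤ y → 0ℝ ≤ x + y
0≤x+y 0≤x 0≤y = ≤-trans (≃⇒≤ (≃-pointwise λ _ → ≡.refl)) (+-mono-≤ 0≤x 0≤y)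

-- A lower bound on a real constrains its terms only eventually and up to ε. Clamping chooses an
-- equal representative all of whose terms obey the bound exactly.
clamp : ℚ → ℝ → ℝ
clamp c x = mkℝ (λ n → seq x n ℚ.⊔ c) λ ε ε>0 →
  proj₁ (cauchy x ε ε>0) , λ m n N≤m N≤n →
    ℚ.≤-trans (∣⊔-⊔∣≤ (seq x m) (seq x n) c) (proj₂ (cauchy x ε ε>0) m n N≤m N≤n)

≃-clamp : ∀ {c x} → fromℚ c ≤ x → x ≃ clamp c x
≃-clamp {c} {x} (mk≤ c≤x) = ≤-antisym
  (≤-pointwise {x} {clamp c x} λ n → ℚ.p≤p⊔q (seq x n) c)
  (mk≤ λ ε ε>0 → map-eventually
    (λ {n} c≤ → ℚ.⊔-lub (p≤p+ (seq x n) ε>0) c≤) (c≤x ε ε>0))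

-- Terms of a nonnegative real may be slightly negative; after clamping both factors at zero the
-- product is nonnegative term by term.
0≤x*y : ∀ {x y} → 0ℝ ≤ x → 0ℝ ≤ y → 0ℝ ≤ x * y
0≤x*y {x} {y} 0≤x 0≤y = ≤-trans
  (≤-pointwise {0ℝ} {clamp 0ℚ x * clamp 0ℚ y} λ n →
    0≤p*q (ℚ.p≤q⊔p (seq x n) 0ℚ) (ℚ.p≤q⊔p (seq y n) 0ℚ))
  (≃⇒≤ (≃-sym (*-cong (≃-clamp 0≤x) (≃-clamp 0≤y))))

0≤x*x : ∀ x → 0ℝ ≤ x * x
0≤x*x x = ≤-pointwise {0ℝ} {x * x} λ n → 0≤p*p (seq x n)

*-monoˡ-≤ : ∀ {x y z} → 0ℝ ≤ z → x ≤ y → z * x ≤ z * y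
*-monoˡ-≤ {x} {y} {z} 0≤z x≤y = 0≤y-x⇒x≤y (≤-trans (0≤x*y 0≤z (x≤y⇒0≤y-x x≤y))
  (≃⇒≤ (solve 3 (λ x y z → z :* (y :- x) := z :* y :- z :* x) ≃-refl x y z)))
  where open ℝ-Solver

0≤x+x⇒0≤x : ∀ {x} → 0ℝ ≤ x + x → 0ℝ ≤ x
0≤x+x⇒0≤x {x} 0≤x+x = ≤-trans
  (0≤x*y (≤-pointwise {0ℝ} {fromℚ ½} λ _ → toWitness {a? = 0ℚ ℚ.≤? ½} _) 0≤x+x)
  (≃⇒≤ (solve 1 (λ x → con ½ :* (x :+ x) := x) ≃-refl x))
  where open ℝ-Solver

-- Bounding x below by a positive rational δ makes the inverses of the terms
-- of clamp δ x, which are all at least δ, a Cauchy sequence.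
inverse-of-positive : ∀ {δ x} → 0ℚ ℚ.< δ → fromℚ δ ≤ x →
  Σ[ r ∈ ℝ ] (0ℝ ≤ r × x * r ≃ 1ℝ)
inverse-of-positive {δ} {x} δ>0 δ≤x = r ,
  ≤-pointwise {0ℝ} {r} (λ n → ℚ.<⇒≤ (reciprocal>0 (y>0 n))) ,
  ≃-trans (*-cong (≃-clamp δ≤x) (≃-refl {r}))
    (≃-pointwise {clamp δ x * r} {1ℝ} λ n → *-reciprocal (y>0 n))
  where
  open ℚ.≤-Reasoning
  y : ℕ → ℚ
  y n = seq x n ℚ.⊔ δ

  δ≤y : ∀ n → δ ℚ.≤ y n
  δ≤y n = ℚ.p≤q⊔p (seq x n) δ

  y>0 : ∀ n → 0ℚ ℚ.< y n
  y>0 n = ℚ.<-≤-trans δ>0 (δ≤y n)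

  1/δ : ℚ
  1/δ = reciprocal δ>0

  -- On rationals at least δ the reciprocal is Lipschitz with constant 1/δ², so the tolerance δ²ε on
  -- `y` yields ε on its reciprocals.
  η : ℚ → ℚ
  η ε = δ ℚ.* (δ ℚ.* ε)

  η>0 : ∀ {ε} → 0ℚ ℚ.< ε → 0ℚ ℚ.< η ε
  η>0 ε>0 = 0<p*q δ>0 (0<p*q δ>0 ε>0)

  scale : ∀ ε m n → ∣ y m ℚ.- y n ∣ ℚ.≤ η ε → ∣ reciprocal (y>0 m) ℚ.- reciprocal (y>0 n) ∣ ℚ.≤ ε
  scale ε m n close = begin
    ∣ reciprocal (y>0 m) ℚ.- reciprocal (y>0 n) ∣
      ≤⟨ ∣reciprocal-reciprocal∣≤ (y>0 m) (y>0 n) δ>0 (δ≤y m) (δ≤y n) ⟩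
    1/δ ℚ.* 1/δ ℚ.* ∣ y m ℚ.- y n ∣
      ≤⟨ ℚ.*-monoˡ-≤-nonNeg (1/δ ℚ.* 1/δ)
           {{ℚ.nonNegative (ℚ.<⇒≤ (0<p*q (reciprocal>0 δ>0) (reciprocal>0 δ>0)))}} close ⟩
    1/δ ℚ.* 1/δ ℚ.* (δ ℚ.* (δ ℚ.* ε))
      ≡⟨ solve 3 (λ r d e → r :* r :* (d :* (d :* e)) := d :* (r :* (d :* (r :* e))))
           ≡.refl 1/δ δ ε ⟩
    δ ℚ.* (1/δ ℚ.* (δ ℚ.* (1/δ ℚ.* ε)))
      ≡⟨ *-reciprocal-* δ>0 (δ ℚ.* (1/δ ℚ.* ε)) ⟩
    δ ℚ.* (1/δ ℚ.* ε)
      ≡⟨ *-reciprocal-* δ>0 ε ⟩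
    ε ∎
    where open +-*-Solver

  r : ℝ
  r = mkℝ (λ n → reciprocal (y>0 n)) λ ε ε>0 →
    proj₁ (cauchy (clamp δ x) (η ε) (η>0 ε>0)) , λ m n N≤m N≤n →
      scale ε m n (proj₂ (cauchy (clamp δ x) (η ε) (η>0 ε>0)) m n N≤m N≤n)

-- Turns strict inequality into a positive rational lower bound; for `γ < 1ℝ` this is the δ that
-- elimination requires.
<⇒gap≤ : ∀ {x y} (x<y : x < y) → fromℚ (_<_.gap x<y) ≤ y - x
<⇒gap≤ {x} {y} (mk< gap gap>0 separate) = mk≤ λ ε ε>0 →
  map-eventually (λ {n} x+gap≤y → begin
    gap                                ≡⟨ solve 2 (λ g x → g := x :+ g :- x) ≡.refl gap (seq x n) ⟩
    seq x n ℚ.+ gap ℚ.- seq x n        ≤⟨ ℚ.+-monoˡ-≤ (ℚ.- seq x n) x+gap≤y ⟩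
    seq y n ℚ.- seq x n                ≤⟨ p≤p+ (seq y n ℚ.- seq x n) ε>0 ⟩
    seq y n ℚ.- seq x n ℚ.+ ε          ∎) separate
  where
  open ℚ.≤-Reasoning
  open +-*-Solver

-- Sums, dot products and quadratic forms

sum-mono-≤ : ∀ {n} {f g : Vector ℝ n} → (∀ i → f i ≤ g i) → sum f ≤ sum g
sum-mono-≤ {ℕ.zero}  f≤g = ≃⇒≤ ≃-refl
sum-mono-≤ {ℕ.suc n} f≤g = +-mono-≤ (f≤g zero) (sum-mono-≤ (f≤g ∘ suc))

0≤sum : ∀ {n} {f : Vector ℝ n} → (∀ i → 0ℝ ≤ f i) → 0ℝ ≤ sum f
0≤sum {n} 0≤f = ≤-trans (≃⇒≤ (≃-sym (sum-replicate-zero n))) (sum-mono-≤ 0≤f)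

sum≤0 : ∀ {n} {f : Vector ℝ n} → (∀ i → f i ≤ 0ℝ) → sum f ≤ 0ℝ
sum≤0 {n} f≤0 = ≤-trans (sum-mono-≤ f≤0) (≃⇒≤ (sum-replicate-zero n))

-- The normal form for splitting sums: summands are first brought into this shape by the solver,
-- which explains the explicit factors `1ℝ` further on.
sum-linear : ∀ {n} a b (f g : Vector ℝ n) →
  sum (λ i → a * f i + b * g i) ≃ a * sum f + b * sum g
sum-linear a b f g = begin
  sum (λ i → a * f i + b * g i)              ≈⟨ ∑-distrib-+ (λ i → a * f i) (λ i → b * g i) ⟩
  sum (λ i → a * f i) + sum (λ i → b * g i)  ≈⟨ +-cong (*-distribˡ-sum a f) (*-distribˡ-sum b g) ⟨
  a * sum f + b * sum g                      ∎
  where open ≃-Reasoning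

·-comm : ∀ {n} (u v : Vector ℝ n) → u · v ≃ v · u
·-comm u v = sum-cong-≋ λ i → *-comm (u i) (v i)

·-congˡ : ∀ {n} (u : Vector ℝ n) {v w} → (∀ i → v i ≃ w i) → u · v ≃ u · w
·-congˡ u v≃w = sum-cong-≋ λ i → *-cong (≃-refl {u i}) (v≃w i)

·-linearʳ : ∀ {n} (u : Vector ℝ n) a b (v w : Vector ℝ n) →
  u · (λ i → a * v i + b * w i) ≃ a * (u · v) + b * (u · w)
·-linearʳ u a b v w = ≃-trans
  (sum-cong-≋ λ i → solve 5
    (λ u a b v w → u :* (a :* v :+ b :* w) := a :* (u :* v) :+ b :* (u :* w))
    ≃-refl (u i) a b (v i) (w i))
  (sum-linear a b (λ i → u i * v i) (λ i → u i * w i))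
  where open ℝ-Solver

·-linearˡ : ∀ {n} a b (u v w : Vector ℝ n) →
  (λ i → a * u i + b * v i) · w ≃ a * (u · w) + b * (v · w)
·-linearˡ a b u v w = ≃-trans (·-comm (λ i → a * u i + b * v i) w)
  (≃-trans (·-linearʳ w a b u v)
    (+-cong (*-congˡ a (·-comm w u)) (*-congˡ b (·-comm w v))))

-- `𝐈 (suc i) (suc j)` computes to `𝐈 i j`, so induction on the indices replaces reasoning about the
-- decision procedure.
𝐈-sym : ∀ {n} (i j : Fin n) → 𝐈 i j ≃ 𝐈 j i
𝐈-sym zero    zero    = ≃-refl
𝐈-sym zero    (suc j) = ≃-refl
𝐈-sym (suc i) zero    = ≃-refl
𝐈-sym (suc i) (suc j) = 𝐈-sym i j

𝐈-off-diagonal : ∀ {n} {i j : Fin n} → i ≢ j → 𝐈 i j ≃ 0ℝ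
𝐈-off-diagonal {i = i} {j} i≢j with i Fin.≟ j
... | yes i≡j = contradiction i≡j i≢j
... | no  _   = ≃-refl

·-𝐈 : ∀ {n} (v : Vector ℝ n) j → v · (λ i → 𝐈 i j) ≃ v j
·-𝐈 {ℕ.suc n} v zero = begin
  v zero * 1ℝ + sum (λ i → v (suc i) * 0ℝ)  ≈⟨ +-congˡ {v zero * 1ℝ} (*-distribʳ-sum 0ℝ (v ∘ suc)) ⟨
  v zero * 1ℝ + sum (v ∘ suc) * 0ℝ          ≈⟨ solve 2 (λ a b → a :* con 1ℚ :+ b :* con 0ℚ := a)
                                                 ≃-refl (v zero) (sum (v ∘ suc)) ⟩
  v zero                                    ∎
  where
  open ≃-Reasoning
  open ℝ-Solver
·-𝐈 {ℕ.suc n} v (suc j) = begin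
  v zero * 0ℝ + (v ∘ suc) · (λ i → 𝐈 i j)  ≈⟨ +-congˡ {v zero * 0ℝ} (·-𝐈 (v ∘ suc) j) ⟩
  v zero * 0ℝ + v (suc j)                  ≈⟨ solve 2 (λ a b → a :* con 0ℚ :+ b := b)
                                                ≃-refl (v zero) (v (suc j)) ⟩
  v (suc j)                                ∎
  where
  open ≃-Reasoning
  open ℝ-Solver

-- Exchange the two summations, then use the symmetry of each entry.
self-adjoint : ∀ {n} {A : Matrix n n} → IsSymmetric A → ∀ u v → u · (A *ᵥ v) ≃ v · (A *ᵥ u)
self-adjoint {A = A} A-sym u v = begin
  sum (λ i → u i * sum (λ j → A i j * v j))
    ≈⟨ sum-cong-≋ (λ i → *-distribˡ-sum (u i) (λ j → A i j * v j)) ⟩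
  sum (λ i → sum (λ j → u i * (A i j * v j)))
    ≈⟨ ∑-comm (λ i j → u i * (A i j * v j)) ⟩
  sum (λ j → sum (λ i → u i * (A i j * v j)))
    ≈⟨ sum-cong-≋ (λ j → sum-cong-≋ λ i → ≃-trans
         (solve 3 (λ u a v → u :* (a :* v) := v :* (a :* u)) ≃-refl (u i) (A i j) (v j))
         (*-congˡ (v j) (*-cong (A-sym i j) (≃-refl {u i})))) ⟩
  sum (λ j → sum (λ i → v j * (A j i * u i)))
    ≈⟨ sum-cong-≋ (λ j → *-distribˡ-sum (v j) (λ i → A j i * u i)) ⟨
  sum (λ j → v j * sum (λ i → A j i * u i)) ∎
  where
  open ≃-Reasoning
  open ℝ-Solver

-- Gaussian elimination

-- Block form of `A`: pivot `a`, rest of the first row `b`, rest of the first column `c`, remaining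
-- block `D`. With `r` the inverse of the pivot, `S` is D - c r b, the matrix left after clearing
-- the first column.
module SchurComplement {n} (A : Matrix (ℕ.suc n) (ℕ.suc n)) (r : ℝ) (a*r≃1 : A zero zero * r ≃ 1ℝ) where
  open ≃-Reasoning
  open ℝ-Solver

  a : ℝ
  a = A zero zero

  b c : Vector ℝ n
  b j = A zero (suc j)
  c i = A (suc i) zero

  D : Matrix n n
  D i j = A (suc i) (suc j)

  -- The factor 1ℝ gives each row the shape of the linear combinations in
  -- sum-linear and ·-linearˡ.
  S : Matrix n n
  S i j = 1ℝ * D i j + - (c i * r) * b j

  -- The entries of `b` and `c` lie off the diagonal of `A`, so c r b is a product of two
  -- nonpositive factors and a nonnegative one; subtracting it keeps an entry nonpositive.
  S-off-diagonal≤0 : 0ℝ ≤ r → (∀ {i j} → i ≢ j → A i j ≤ 0ℝ) → ∀ {i j} → i ≢ j → S i j ≤ 0ℝ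
  S-off-diagonal≤0 0≤r A≤0 {i} {j} i≢j = 0≤y-x⇒x≤y {S i j} (≤-trans
    (0≤x+y {(- D i j)} { - c i * r * - b j}
      (x≤0⇒0≤-x {D i j} (A≤0 {suc i} {suc j} (i≢j ∘ Fin.suc-injective)))
      (0≤x*y { - c i * r} { - b j}
        (0≤x*y { - c i} {r} (x≤0⇒0≤-x {c i} (A≤0 {suc i} {zero} λ ())) 0≤r)
        (x≤0⇒0≤-x {b j} (A≤0 {zero} {suc j} λ ()))))
    (≃⇒≤ (solve 4
      (λ d c r b → :- d :+ (:- c) :* r :* (:- b) := con 0ℚ :- (con 1ℚ :* d :+ (:- (c :* r)) :* b))
      ≃-refl (D i j) (c i) r (b j))))

  -- Row `i` of `S` is row `suc i` of `A` plus -c r times row `zero`; the entries in the first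
  -- column cancel, so whole row sums of `A` may be used.
  sum-S : ∀ i → sum (S i) ≃ c i + sum (D i) + - c i * r * (a + sum b)
  sum-S i = begin
    sum (S i)
      ≈⟨ sum-linear 1ℝ (- (c i * r)) (D i) b ⟩
    1ℝ * sum (D i) + - (c i * r) * sum b
      -- The cancellation is isolated in the residual c (a r - 1), which vanishes by `a*r≃1`.
      ≈⟨ solve 5 (λ d c r b a → con 1ℚ :* d :+ (:- (c :* r)) :* b :=
           c :+ d :+ (:- c) :* r :* (a :+ b) :+ c :* (a :* r :- con 1ℚ))
           ≃-refl (sum (D i)) (c i) r (sum b) a ⟩
    c i + sum (D i) + - c i * r * (a + sum b) + c i * (a * r - 1ℝ)
      ≈⟨ +-congˡ {c i + sum (D i) + - c i * r * (a + sum b)}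
           (*-congˡ (c i) (+-cong {y = - 1ℝ} a*r≃1 ≃-refl)) ⟩
    c i + sum (D i) + - c i * r * (a + sum b) + c i * (1ℝ - 1ℝ)
      ≈⟨ solve 2 (λ s c → s :+ c :* (con 1ℚ :- con 1ℚ) := s) ≃-refl
           (c i + sum (D i) + - c i * r * (a + sum b)) (c i) ⟩
    c i + sum (D i) + - c i * r * (a + sum b) ∎

  -- The multiplier -c r is nonnegative and row `zero` has nonnegative sum, so elimination can only
  -- raise row sums. The same δ therefore serves at every stage.
  S-rows : ∀ {δ} → 0ℝ ≤ δ → 0ℝ ≤ r → (∀ {i j} → i ≢ j → A i j ≤ 0ℝ) →
    (∀ i → δ ≤ sum (A i)) → ∀ i → δ ≤ sum (S i)
  S-rows {δ} 0≤δ 0≤r A≤0 δ≤rows i = ≤-trans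
    (≃⇒≤ (solve 1 (λ d → d := d :+ con 0ℚ) ≃-refl δ))
    (≤-trans
      (+-mono-≤ {δ} {c i + sum (D i)} {0ℝ} { - c i * r * (a + sum b)} (δ≤rows (suc i))
        (0≤x*y { - c i * r} {a + sum b}
          (0≤x*y { - c i} {r} (x≤0⇒0≤-x {c i} (A≤0 {suc i} {zero} λ ())) 0≤r)
          (≤-trans 0≤δ (δ≤rows zero))))
      (≃⇒≤ (≃-sym (sum-S i))))

  -- The first equation determines the first unknown as r (v₀ - b·y). Inserted into a later row, it
  -- leaves S y + c r v₀.
  substitute-back : ∀ (v : Vector ℝ (ℕ.suc n)) (y : Vector ℝ n) → (∀ i → (S *ᵥ y) i ≃ v (suc i) - c i * (r * v zero)) →
    ∀ i → (A *ᵥ (r * (v zero - b · y) ∷ y)) i ≃ v i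
  substitute-back v y Sy≃ zero = begin
    a * (r * (v zero - b · y)) + b · y
      ≈⟨ solve 4 (λ a r v s → a :* (r :* (v :- s)) :+ s := a :* r :* (v :- s) :+ s)
           ≃-refl a r (v zero) (b · y) ⟩
    a * r * (v zero - b · y) + b · y
      ≈⟨ +-congʳ {b · y} (*-cong {y = v zero - b · y} a*r≃1 ≃-refl) ⟩
    1ℝ * (v zero - b · y) + b · y
      ≈⟨ solve 2 (λ v s → con 1ℚ :* (v :- s) :+ s := v) ≃-refl (v zero) (b · y) ⟩
    v zero ∎
  substitute-back v y Sy≃ (suc i) = begin
    c i * (r * (v zero - b · y)) + D i · y
      ≈⟨ solve 5 (λ c r v s d → c :* (r :* (v :- s)) :+ d :=
           con 1ℚ :* d :+ (:- (c :* r)) :* s :+ c :* (r :* v))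
           ≃-refl (c i) r (v zero) (b · y) (D i · y) ⟩
    1ℝ * (D i · y) + - (c i * r) * (b · y) + c i * (r * v zero)
      ≈⟨ +-congʳ {c i * (r * v zero)} (·-linearˡ 1ℝ (- (c i * r)) (D i) b y) ⟨
    (S *ᵥ y) i + c i * (r * v zero)
      ≈⟨ +-congʳ {c i * (r * v zero)} (Sy≃ i) ⟩
    v (suc i) - c i * (r * v zero) + c i * (r * v zero)
      ≈⟨ solve 2 (λ v s → v :- s :+ s := v) ≃-refl (v (suc i)) (c i * (r * v zero)) ⟩
    v (suc i) ∎

-- The pivot is at least δ: it is a row sum minus nonpositive entries.
eliminate : ∀ {n} {δ} → 0ℚ ℚ.< δ → (A : Matrix n n) →
  (∀ {i j} → i ≢ j → A i j ≤ 0ℝ) → (∀ i → fromℚ δ ≤ sum (A i)) →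
  (v : Vector ℝ n) → Σ[ x ∈ Vector ℝ n ] (∀ i → (A *ᵥ x) i ≃ v i)
eliminate {ℕ.zero}  δ>0 A A≤0 δ≤rows v = (λ ()) , λ ()
eliminate {ℕ.suc n} {δ} δ>0 A A≤0 δ≤rows v =
  let r , 0≤r , a*r≃1 = inverse-of-positive δ>0 δ≤a in step r 0≤r a*r≃1
  where
  open ℝ-Solver
  a : ℝ
  a = A zero zero

  δ≤a : fromℚ δ ≤ a
  δ≤a = ≤-trans (δ≤rows zero) (≤-trans
    (+-mono-≤ {a} {a} {sum (A zero ∘ suc)} {0ℝ} (≃⇒≤ ≃-refl) (sum≤0 λ j → A≤0 {zero} {suc j} λ ()))
    (≃⇒≤ (solve 1 (λ a → a :+ con 0ℚ := a) ≃-refl a)))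

  step : ∀ r → 0ℝ ≤ r → a * r ≃ 1ℝ → Σ[ x ∈ Vector ℝ (ℕ.suc n) ] (∀ i → (A *ᵥ x) i ≃ v i)
  step r 0≤r a*r≃1 =
    let y , Sy≃ = eliminate δ>0 S (S-off-diagonal≤0 0≤r A≤0)
                    (S-rows (≤-pointwise {0ℝ} {fromℚ δ} λ _ → ℚ.<⇒≤ δ>0) 0≤r A≤0 δ≤rows)
                    -- The right-hand side undergoes the same row operation as the matrix.
                    (λ i → v (suc i) - c i * (r * v zero))
    in r * (v zero - b · y) ∷ y , substitute-back v y Sy≃
    where open SchurComplement A r a*r≃1 hiding (a)

-- Solving for the columns of the identity gives B with AB = I. Pairing column j of B with A times
-- column i and moving A across shows that B is symmetric.
symmetric-solvable⇒invertible : ∀ {n} {A : Matrix n n} → IsSymmetric A →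
  ((v : Vector ℝ n) → Σ[ x ∈ Vector ℝ n ] (∀ i → (A *ᵥ x) i ≃ v i)) → Invertible A
symmetric-solvable⇒invertible {n} {A} A-sym solution = record
  { inverse  = B
  ; inverseˡ = λ i j → begin
      -- With both matrices symmetric, BA is the transpose of AB.
      B i · (λ k → A k j)          ≈⟨ sum-cong-≋ (λ k → *-cong (B-sym i k) (A-sym k j)) ⟩
      (λ k → B k i) · A j          ≈⟨ ·-comm (λ k → B k i) (A j) ⟩
      (A ⊗ B) j i                  ≈⟨ right j i ⟩
      𝐈 j i                        ≈⟨ 𝐈-sym j i ⟩
      𝐈 i j                        ∎
  ; inverseʳ = right
  }
  where
  open ≃-Reasoning
  B : Matrix n n
  B i j = proj₁ (solution λ k → 𝐈 k j) i

  column : Fin n → Vector ℝ n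
  column j i = B i j

  right : A ⊗ B ≋ 𝐈
  right i j = proj₂ (solution λ k → 𝐈 k j) i

  B-sym : IsSymmetric B
  B-sym i j = begin
    B i j                          ≈⟨ ·-𝐈 (column j) i ⟨
    column j · (λ k → 𝐈 k i)       ≈⟨ ·-congˡ (column j) (λ k → right k i) ⟨
    column j · (A *ᵥ column i)     ≈⟨ self-adjoint A-sym (column j) (column i) ⟩
    column i · (A *ᵥ column j)     ≈⟨ ·-congˡ (column i) (λ k → right k j) ⟩
    column i · (λ k → 𝐈 k j)       ≈⟨ ·-𝐈 (column i) j ⟩
    B j i                          ∎

-- Positive semidefiniteness

row-sums : ∀ {n} {M : Matrix n n} → IsSymmetric M → IsStochastic M → ∀ i → sum (M i) ≃ 1ℝ
row-sums M-sym (_ , columns) i = ≃-trans (sum-cong-≋ λ j → M-sym i j) (columns i)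

-- Expanding the nonnegative double sum yields `v · v` twice: once from the row sums, in `inner`,
-- and once from the column sums, in `transposed`. The resulting doubled inequality is then halved.
v·Mv≤v·v : ∀ {n} {M : Matrix n n} → IsSymmetric M → IsStochastic M →
  ∀ v → 0ℝ ≤ v · v - v · (M *ᵥ v)
v·Mv≤v·v {n} {M} M-sym M-stochastic v = 0≤x+x⇒0≤x (≤-trans
  (0≤sum λ i → 0≤sum λ j → 0≤x*y (proj₁ M-stochastic i j) (0≤x*x (v i - v j)))
  (≃⇒≤ expand))
  where
  open ≃-Reasoning
  open ℝ-Solver
  w : Vector ℝ n
  w i = v i * v i

  transposed : sum (M *ᵥ w) ≃ v · v
  transposed = begin
    sum (λ i → sum (λ j → M i j * w j))  ≈⟨ ∑-comm (λ i j → M i j * w j) ⟩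
    sum (λ j → sum (λ i → M i j * w j))  ≈⟨ sum-cong-≋ (λ j → *-distribʳ-sum (w j) (λ i → M i j)) ⟨
    sum (λ j → sum (λ i → M i j) * w j)  ≈⟨ sum-cong-≋ (λ j → *-cong {y = w j} (proj₂ M-stochastic j) ≃-refl) ⟩
    sum (λ j → 1ℝ * w j)                 ≈⟨ sum-cong-≋ (λ j → solve 1 (λ w → con 1ℚ :* w := w) ≃-refl (w j)) ⟩
    sum w                                ∎

  inner : ∀ i → sum (λ j → M i j * ((v i - v j) * (v i - v j))) ≃
    1ℝ * (w i + (M *ᵥ w) i) + fromℚ (ℚ.- (1ℚ ℚ.+ 1ℚ)) * (v i * (M *ᵥ v) i)
  inner i = begin
    sum (λ j → M i j * ((v i - v j) * (v i - v j)))
      -- The square is split into its two squares and the cross term, with factors depending on `i`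
      -- alone placed as scalars, ready for two uses of `sum-linear`.
      ≈⟨ sum-cong-≋ (λ j → solve 3 (λ m x y → m :* ((x :- y) :* (x :- y)) :=
           con 1ℚ :* (x :* x :* m :+ con 1ℚ :* (m :* (y :* y))) :+ (:- (x :+ x)) :* (m :* y))
           ≃-refl (M i j) (v i) (v j)) ⟩
    sum (λ j → 1ℝ * (w i * M i j + 1ℝ * (M i j * w j)) + - (v i + v i) * (M i j * v j))
      ≈⟨ sum-linear 1ℝ (- (v i + v i)) (λ j → w i * M i j + 1ℝ * (M i j * w j)) (λ j → M i j * v j) ⟩
    1ℝ * sum (λ j → w i * M i j + 1ℝ * (M i j * w j)) + - (v i + v i) * (M *ᵥ v) i
      ≈⟨ +-congʳ { - (v i + v i) * (M *ᵥ v) i}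
           (*-congˡ 1ℝ (sum-linear (w i) 1ℝ (M i) (λ j → M i j * w j))) ⟩
    1ℝ * (w i * sum (M i) + 1ℝ * (M *ᵥ w) i) + - (v i + v i) * (M *ᵥ v) i
      ≈⟨ +-congʳ { - (v i + v i) * (M *ᵥ v) i}
           (*-congˡ 1ℝ (+-congʳ {1ℝ * (M *ᵥ w) i} (*-congˡ (w i) (row-sums M-sym M-stochastic i)))) ⟩
    1ℝ * (w i * 1ℝ + 1ℝ * (M *ᵥ w) i) + - (v i + v i) * (M *ᵥ v) i
      ≈⟨ solve 4 (λ x w mw mv → con 1ℚ :* (w :* con 1ℚ :+ con 1ℚ :* mw) :+ (:- (x :+ x)) :* mv :=
           con 1ℚ :* (w :+ mw) :+ con (ℚ.- (1ℚ ℚ.+ 1ℚ)) :* (x :* mv))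
           ≃-refl (v i) (w i) ((M *ᵥ w) i) ((M *ᵥ v) i) ⟩
    1ℝ * (w i + (M *ᵥ w) i) + fromℚ (ℚ.- (1ℚ ℚ.+ 1ℚ)) * (v i * (M *ᵥ v) i) ∎

  expand : sum (λ i → sum (λ j → M i j * ((v i - v j) * (v i - v j)))) ≃
    v · v - v · (M *ᵥ v) + (v · v - v · (M *ᵥ v))
  expand = begin
    sum (λ i → sum (λ j → M i j * ((v i - v j) * (v i - v j))))
      ≈⟨ sum-cong-≋ inner ⟩
    sum (λ i → 1ℝ * (w i + (M *ᵥ w) i) + fromℚ (ℚ.- (1ℚ ℚ.+ 1ℚ)) * (v i * (M *ᵥ v) i))
      ≈⟨ sum-linear 1ℝ (fromℚ (ℚ.- (1ℚ ℚ.+ 1ℚ))) (λ i → w i + (M *ᵥ w) i) (λ i → v i * (M *ᵥ v) i) ⟩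
    1ℝ * sum (λ i → w i + (M *ᵥ w) i) + fromℚ (ℚ.- (1ℚ ℚ.+ 1ℚ)) * (v · (M *ᵥ v))
      ≈⟨ +-congʳ {fromℚ (ℚ.- (1ℚ ℚ.+ 1ℚ)) * (v · (M *ᵥ v))} (*-congˡ 1ℝ
           (≃-trans (∑-distrib-+ w (M *ᵥ w)) (+-congˡ {v · v} transposed))) ⟩
    1ℝ * (v · v + v · v) + fromℚ (ℚ.- (1ℚ ℚ.+ 1ℚ)) * (v · (M *ᵥ v))
      ≈⟨ solve 2 (λ n q → con 1ℚ :* (n :+ n) :+ con (ℚ.- (1ℚ ℚ.+ 1ℚ)) :* q := n :- q :+ (n :- q))
           ≃-refl (v · v) (v · (M *ᵥ v)) ⟩
    v · v - v · (M *ᵥ v) + (v · v - v · (M *ᵥ v)) ∎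

PositiveSemidefinite : ∀ {n} → Matrix n n → Set
PositiveSemidefinite {n} A = (v : Vector ℝ n) → 0ℝ ≤ v · (A *ᵥ v)

module Resolvent {n} {M : Matrix n n} (M-sym : IsSymmetric M) (M-stochastic : IsStochastic M)
                 {γ} (0≤γ : 0ℝ ≤ γ) (γ<1 : γ < 1ℝ) where
  open ≃-Reasoning
  open ℝ-Solver

  A : Matrix n n
  A = 𝐈 ⊖ γ • M

  A-sym : IsSymmetric A
  A-sym i j = +-cong (𝐈-sym i j) (neg-cong (*-congˡ γ (M-sym i j)))

  0≤1-γ : 0ℝ ≤ 1ℝ - γ
  0≤1-γ = ≤-trans (≤-pointwise {0ℝ} {fromℚ (_<_.gap γ<1)} λ _ → ℚ.<⇒≤ (_<_.gap>0 γ<1)) (<⇒gap≤ γ<1)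

  *ᵥ-resolvent : ∀ v i → (A *ᵥ v) i ≃ 1ℝ * v i + - γ * (M *ᵥ v) i
  *ᵥ-resolvent v i = begin
    sum (λ j → A i j * v j)
      ≈⟨ sum-cong-≋ (λ j → solve 4 (λ e g m v → (e :- g :* m) :* v :=
           con 1ℚ :* (v :* e) :+ (:- g) :* (m :* v)) ≃-refl (𝐈 i j) γ (M i j) (v j)) ⟩
    sum (λ j → 1ℝ * (v j * 𝐈 i j) + - γ * (M i j * v j))
      ≈⟨ sum-linear 1ℝ (- γ) (λ j → v j * 𝐈 i j) (λ j → M i j * v j) ⟩
    1ℝ * (v · 𝐈 i) + - γ * (M *ᵥ v) i
      ≈⟨ +-congʳ { - γ * (M *ᵥ v) i} (*-congˡ 1ℝ
           (≃-trans (·-congˡ v (𝐈-sym i)) (·-𝐈 v i))) ⟩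
    1ℝ * v i + - γ * (M *ᵥ v) i ∎

  -- I - γM = γ(I - M) + (1 - γ)I, a combination of positive semidefinite matrices with nonnegative
  -- coefficients.
  A-psd : PositiveSemidefinite A
  A-psd v = ≤-trans
    (0≤x+y (0≤x*y 0≤γ (v·Mv≤v·v M-sym M-stochastic v))
      (0≤x*y 0≤1-γ (0≤sum λ i → 0≤x*x (v i))))
    (≃⇒≤ (begin
      γ * (v · v - v · (M *ᵥ v)) + (1ℝ - γ) * (v · v)
        ≈⟨ solve 3 (λ g n q → g :* (n :- q) :+ (con 1ℚ :- g) :* n := con 1ℚ :* n :+ (:- g) :* q)
             ≃-refl γ (v · v) (v · (M *ᵥ v)) ⟩
      1ℝ * (v · v) + - γ * (v · (M *ᵥ v))
        ≈⟨ ·-linearʳ v 1ℝ (- γ) v (M *ᵥ v) ⟨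
      v · (λ i → 1ℝ * v i + - γ * (M *ᵥ v) i)
        ≈⟨ ·-congˡ v (*ᵥ-resolvent v) ⟨
      v · (A *ᵥ v) ∎))

  off-diagonal≤0 : ∀ {i j} → i ≢ j → A i j ≤ 0ℝ
  off-diagonal≤0 {i} {j} i≢j = 0≤y-x⇒x≤y (≤-trans
    (0≤x*y 0≤γ (proj₁ M-stochastic i j))
    (≃⇒≤ (begin
      γ * M i j                ≈⟨ solve 1 (λ x → x := con 0ℚ :- (con 0ℚ :- x)) ≃-refl (γ * M i j) ⟩
      0ℝ - (0ℝ - γ * M i j)    ≈⟨ +-congˡ {0ℝ} (neg-cong (+-congʳ { - (γ * M i j)} (𝐈-off-diagonal i≢j))) ⟨
      0ℝ - A i j               ∎)))

  sum-row : ∀ i → sum (A i) ≃ 1ℝ - γ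
  sum-row i = begin
    sum (A i)
      -- The inner factor `1ℝ` makes the identity part a dot product with the all-ones vector, which
      -- `·-𝐈` evaluates.
      ≈⟨ sum-cong-≋ (λ j → solve 3 (λ e g m → e :- g :* m :=
           con 1ℚ :* (con 1ℚ :* e) :+ (:- g) :* m) ≃-refl (𝐈 i j) γ (M i j)) ⟩
    sum (λ j → 1ℝ * (1ℝ * 𝐈 i j) + - γ * M i j)
      ≈⟨ sum-linear 1ℝ (- γ) (λ j → 1ℝ * 𝐈 i j) (M i) ⟩
    1ℝ * ((λ _ → 1ℝ) · 𝐈 i) + - γ * sum (M i)
      ≈⟨ +-cong (*-congˡ 1ℝ (≃-trans (·-congˡ (λ _ → 1ℝ) (𝐈-sym i)) (·-𝐈 (λ _ → 1ℝ) i)))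
           (*-congˡ (- γ) (row-sums M-sym M-stochastic i)) ⟩
    1ℝ * 1ℝ + - γ * 1ℝ
      ≈⟨ solve 1 (λ g → con 1ℚ :* con 1ℚ :+ (:- g) :* con 1ℚ := con 1ℚ :- g) ≃-refl γ ⟩
    1ℝ - γ ∎

  -- Every row sum is 1 - γ, hence at least the rational gap in `γ<1`, which serves as δ.
  A-invertible : Invertible A
  A-invertible = symmetric-solvable⇒invertible A-sym
    (eliminate (_<_.gap>0 γ<1) A off-diagonal≤0
      (λ i → ≤-trans (<⇒gap≤ γ<1) (≃⇒≤ (≃-sym (sum-row i)))))

-- Mixtures and convexity

mixture-sym : ∀ {k n} {P : Fin k → Matrix n n} → (∀ a → IsSymmetric (P a)) →
  ∀ π → IsSymmetric (mixture P π)
mixture-sym P-sym π i j = sum-cong-≋ λ a → *-congˡ (π a) (P-sym a i j)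

mixture-stochastic : ∀ {k n} {P : Fin k → Matrix n n} → (∀ a → IsStochastic (P a)) →
  ∀ {π} → π ∈ Δ k → IsStochastic (mixture P π)
mixture-stochastic {k} {P = P} P-stochastic {π} (0≤π , sum-π) =
  (λ i j → 0≤sum λ a → 0≤x*y (0≤π a) (proj₁ (P-stochastic a) i j)) , λ j → begin
    sum (λ i → sum (λ a → π a * P a i j))  ≈⟨ ∑-comm (λ i a → π a * P a i j) ⟩
    sum (λ a → sum (λ i → π a * P a i j))  ≈⟨ sum-cong-≋ (λ a → *-distribˡ-sum (π a) (λ i → P a i j)) ⟨
    sum (λ a → π a * sum (λ i → P a i j))  ≈⟨ sum-cong-≋ (λ a → *-congˡ (π a) (proj₂ (P-stochastic a) j)) ⟩
    sum (λ a → π a * 1ℝ)                   ≈⟨ sum-cong-≋ (λ a → solve 1 (λ p → p :* con 1ℚ := p) ≃-refl (π a)) ⟩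
    sum π                                  ≈⟨ sum-π ⟩
    1ℝ                                     ∎
  where
  open ≃-Reasoning
  open ℝ-Solver

Δ-convex : ∀ k → IsConvex (Δ k)
Δ-convex k x y t (0≤x , sum-x) (0≤y , sum-y) 0≤t t≤1 =
  (λ i → 0≤x+y (0≤x*y 0≤t (0≤x i)) (0≤x*y (x≤y⇒0≤y-x t≤1) (0≤y i))) , (begin
    sum (segment t x y)             ≈⟨ sum-linear t (1ℝ - t) x y ⟩
    t * sum x + (1ℝ - t) * sum y    ≈⟨ +-cong (*-congˡ t sum-x) (*-congˡ (1ℝ - t) sum-y) ⟩
    t * 1ℝ + (1ℝ - t) * 1ℝ          ≈⟨ solve 1 (λ t → t :* con 1ℚ :+ (con 1ℚ :- t) :* con 1ℚ := con 1ℚ)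
                                        ≃-refl t ⟩
    1ℝ                              ∎)
  where
  open ≃-Reasoning
  open ℝ-Solver

-- The mixture is linear in the weights, and since t and 1 - t add up to one the constant term `𝐈`
-- is shared out as well: the matrix is affine in the policy.
mixture-segment : ∀ {k n} γ (P : Fin k → Matrix n n) t x y i j →
  (𝐈 ⊖ γ • mixture P (segment t x y)) i j ≃
    t * (𝐈 ⊖ γ • mixture P x) i j + (1ℝ - t) * (𝐈 ⊖ γ • mixture P y) i j
mixture-segment γ P t x y i j = begin
  𝐈 i j - γ * mixture P (segment t x y) i j
    ≈⟨ +-congˡ {𝐈 i j} (neg-cong (*-congˡ γ (·-linearˡ t (1ℝ - t) x y (λ a → P a i j)))) ⟩
  𝐈 i j - γ * (t * mixture P x i j + (1ℝ - t) * mixture P y i j)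
    ≈⟨ solve 5 (λ e g t p q → e :- g :* (t :* p :+ (con 1ℚ :- t) :* q) :=
         t :* (e :- g :* p) :+ (con 1ℚ :- t) :* (e :- g :* q))
         ≃-refl (𝐈 i j) γ t (mixture P x i j) (mixture P y i j) ⟩
  t * (𝐈 i j - γ * mixture P x i j) + (1ℝ - t) * (𝐈 i j - γ * mixture P y i j) ∎
  where
  open ≃-Reasoning
  open ℝ-Solver

-- The quadratic form of the inverse as a supremum.

quadratic-form-linear : ∀ {n} {A B C : Matrix n n} s t →
  (∀ i j → C i j ≃ s * A i j + t * B i j) →
  ∀ u → u · (C *ᵥ u) ≃ s * (u · (A *ᵥ u)) + t * (u · (B *ᵥ u))
quadratic-form-linear {A = A} {B} s t C≃ u = ≃-trans
  (·-congˡ u λ i → ≃-trans (sum-cong-≋ λ j → *-cong {y = u j} (C≃ i j) ≃-refl)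
    (·-linearˡ s t (A i) (B i) u))
  (·-linearʳ u s t (A *ᵥ u) (B *ᵥ u))

solves : ∀ {n} {A : Matrix n n} (A⁻¹ : Invertible A) v i → (A *ᵥ (inverse A⁻¹ *ᵥ v)) i ≃ v i
solves {A = A} A⁻¹ v i = begin
  sum (λ j → A i j * sum (λ k → B j k * v k))    ≈⟨ sum-cong-≋ (λ j → *-distribˡ-sum (A i j) (λ k → B j k * v k)) ⟩
  sum (λ j → sum (λ k → A i j * (B j k * v k)))  ≈⟨ ∑-comm (λ j k → A i j * (B j k * v k)) ⟩
  sum (λ k → sum (λ j → A i j * (B j k * v k)))  ≈⟨ sum-cong-≋ (λ k → sum-cong-≋ λ j →
                                                      *-assoc (A i j) (B j k) (v k)) ⟨
  sum (λ k → sum (λ j → A i j * B j k * v k))    ≈⟨ sum-cong-≋ (λ k → *-distribʳ-sum (v k) (λ j → A i j * B j k)) ⟨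
  sum (λ k → (A ⊗ B) i k * v k)                  ≈⟨ sum-cong-≋ (λ k → *-cong {y = v k}
                                                      (≃-trans (Invertible.inverseʳ A⁻¹ i k) (𝐈-sym i k)) ≃-refl) ⟩
  sum (λ k → 𝐈 k i * v k)                        ≈⟨ ·-comm (λ k → 𝐈 k i) v ⟩
  v · (λ k → 𝐈 k i)                              ≈⟨ ·-𝐈 v i ⟩
  v i                                            ∎
  where
  open ≃-Reasoning
  B = inverse A⁻¹

-- The gap is the energy (p − u)·A(p − u) of the error of u as a solution of A p = μ.
energy-bound : ∀ {n} {A : Matrix n n} → IsSymmetric A → PositiveSemidefinite A →
  (A⁻¹ : Invertible A) → ∀ μ u →
  u · μ + u · μ - u · (A *ᵥ u) ≤ μ · (inverse A⁻¹ *ᵥ μ)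
energy-bound {n} {A} A-sym A-psd A⁻¹ μ u = 0≤y-x⇒x≤y (≤-trans (A-psd e) (≃⇒≤ (begin
  e · (A *ᵥ e)
    ≈⟨ ·-linearˡ 1ℝ (- 1ℝ) p u (A *ᵥ e) ⟩
  1ℝ * (p · (A *ᵥ e)) + - 1ℝ * (u · (A *ᵥ e))
    ≈⟨ +-cong (*-congˡ 1ℝ (expand p)) (*-congˡ (- 1ℝ) (expand u)) ⟩
  1ℝ * (1ℝ * (p · μ) + - 1ℝ * (p · (A *ᵥ u))) + - 1ℝ * (1ℝ * (u · μ) + - 1ℝ * (u · (A *ᵥ u)))
    -- The cross term p·Au equals u·Ap by symmetry, and Ap = μ.
    ≈⟨ +-congʳ { - 1ℝ * (1ℝ * (u · μ) + - 1ℝ * (u · (A *ᵥ u)))}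
         (*-congˡ 1ℝ (+-cong (*-congˡ 1ℝ (·-comm p μ)) (*-congˡ (- 1ℝ)
           (≃-trans (self-adjoint A-sym p u) (·-congˡ u (solves A⁻¹ μ)))))) ⟩
  1ℝ * (1ℝ * (μ · p) + - 1ℝ * (u · μ)) + - 1ℝ * (1ℝ * (u · μ) + - 1ℝ * (u · (A *ᵥ u)))
    ≈⟨ solve 3 (λ f m q → con 1ℚ :* (con 1ℚ :* f :+ (:- con 1ℚ) :* m) :+
         (:- con 1ℚ) :* (con 1ℚ :* m :+ (:- con 1ℚ) :* q) := f :- (m :+ m :- q))
         ≃-refl (μ · p) (u · μ) (u · (A *ᵥ u)) ⟩
  μ · p - (u · μ + u · μ - u · (A *ᵥ u)) ∎)))
  where
  open ≃-Reasoning
  open ℝ-Solver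
  p e : Vector ℝ n
  p = inverse A⁻¹ *ᵥ μ
  e i = 1ℝ * p i + - 1ℝ * u i

  expand : ∀ w → w · (A *ᵥ e) ≃ 1ℝ * (w · μ) + - 1ℝ * (w · (A *ᵥ u))
  expand w = ≃-trans
    (·-congˡ w λ i → ≃-trans (·-linearʳ (A i) 1ℝ (- 1ℝ) p u)
      (+-congʳ { - 1ℝ * (A *ᵥ u) i} (*-congˡ 1ℝ (solves A⁻¹ μ i))))
    (·-linearʳ w 1ℝ (- 1ℝ) μ (A *ᵥ u))

-- Take u = C⁻¹μ, where the energy bound for `C` is attained. For fixed u the bound is affine in the
-- matrix, so it splits into the bounds for `A` and `B` at this same u, each at most the
-- corresponding value.
inverse-form-convex : ∀ {n} {A B C : Matrix n n} {t} → 0ℝ ≤ t → t ≤ 1ℝ →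
  (∀ i j → C i j ≃ t * A i j + (1ℝ - t) * B i j) →
  IsSymmetric A → PositiveSemidefinite A → IsSymmetric B → PositiveSemidefinite B →
  (A⁻¹ : Invertible A) (B⁻¹ : Invertible B) (C⁻¹ : Invertible C) → ∀ μ →
  μ · (inverse C⁻¹ *ᵥ μ) ≤ t * (μ · (inverse A⁻¹ *ᵥ μ)) + (1ℝ - t) * (μ · (inverse B⁻¹ *ᵥ μ))
inverse-form-convex {n} {A} {B} {C} {t} 0≤t t≤1 C≃ A-sym A-psd B-sym B-psd A⁻¹ B⁻¹ C⁻¹ μ = ≤-trans
  (≃⇒≤ (begin
    μ · u
      ≈⟨ ·-comm μ u ⟩
    u · μ
      -- One copy of u·μ is set aside to become u·Cu, which exhibits the value at `C` in the form
      -- used by `energy-bound`.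
      ≈⟨ solve 1 (λ m → m := m :+ m :- m) ≃-refl (u · μ) ⟩
    u · μ + u · μ - u · μ
      ≈⟨ +-congˡ {u · μ + u · μ} (neg-cong (·-congˡ u (solves C⁻¹ μ))) ⟨
    u · μ + u · μ - u · (C *ᵥ u)
      ≈⟨ +-congˡ {u · μ + u · μ} (neg-cong (quadratic-form-linear {A = A} {B} {C} t (1ℝ - t) C≃ u)) ⟩
    u · μ + u · μ - (t * (u · (A *ᵥ u)) + (1ℝ - t) * (u · (B *ᵥ u)))
      ≈⟨ solve 4 (λ m t a b → m :+ m :- (t :* a :+ (con 1ℚ :- t) :* b) :=
           t :* (m :+ m :- a) :+ (con 1ℚ :- t) :* (m :+ m :- b))
           ≃-refl (u · μ) t (u · (A *ᵥ u)) (u · (B *ᵥ u)) ⟩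
    t * (u · μ + u · μ - u · (A *ᵥ u)) + (1ℝ - t) * (u · μ + u · μ - u · (B *ᵥ u)) ∎))
  (+-mono-≤
    (*-monoˡ-≤ 0≤t (energy-bound A-sym A-psd A⁻¹ μ u))
    (*-monoˡ-≤ (x≤y⇒0≤y-x t≤1) (energy-bound B-sym B-psd B⁻¹ μ u)))
  where
  open ≃-Reasoning
  open ℝ-Solver
  u : Vector ℝ n
  u = inverse C⁻¹ *ᵥ μ

-- The first component provides a family `inv`, so the second is not vacuous. Convexity is
-- quantified over all such families because an inverse is data that may vary with the membership
-- proof.
theorem3 : (n k : ℕ) → .{{_ : NonZero n}} → .{{_ : NonZero k}} →
    (γ : ℝ) → 0ℝ ≤ γ → γ < 1ℝ →
    (P : Fin k → Matrix n n) →
    (∀ a → IsSymmetric (P a)) → (∀ a → IsStochastic (P a)) →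
    (μ : Vector ℝ n) → IsProbability μ →
    (∀ π → π ∈ Δ k → Invertible (𝐈 ⊖ γ • mixture P π)) ×
    ((inv : ∀ π → π ∈ Δ k → Invertible (𝐈 ⊖ γ • mixture P π)) →
    IsConvexOn (Δ k) (λ π π∈Δ → μ · (inverse (inv π π∈Δ) *ᵥ μ)))
theorem3 n k γ 0≤γ γ<1 P P-sym P-stochastic μ _ =
  (λ π π∈Δ → Resolvent.A-invertible (mixture-sym P-sym π) (mixture-stochastic P-stochastic π∈Δ) 0≤γ γ<1) ,
  λ inv → record
    { domain = Δ-convex k
    ; below-chord = λ x y t x∈Δ y∈Δ 0≤t t≤1 z∈Δ →
        inverse-form-convex 0≤t t≤1 (mixture-segment γ P t x y)
          (A-sym x∈Δ) (A-psd x∈Δ) (A-sym y∈Δ) (A-psd y∈Δ)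
          (inv x x∈Δ) (inv y y∈Δ) (inv (segment t x y) z∈Δ) μ
    }
  where
  module A {π} (π∈Δ : π ∈ Δ k) =
    Resolvent (mixture-sym P-sym π) (mixture-stochastic P-stochastic π∈Δ) 0≤γ γ<1
  open A using (A-sym; A-psd)
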